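{- For $pq\ne0$ and $h\ge0$ define $$R_h(x;p,q)=\left[\prod_{k=0}^{h}P_k\!\left(q^{2k-3}px,\tfrac{p^2}{q^2}\right)^2\right]P_{h+1}\!\left(q^{2h-1}px,\tfrac{p^2}{q^2}\right),$$ and set $R_{ -1}(x;p,q)=1$. Then for every $h\ge0$, $$R_h(x;p,q)=R_h(x;q,p),$$ and for every $N\ge0$ the height-truncated generating function $G_N(x,y,p,q)=\sum_{\pi\in\mathcal D,\ h(\pi)\le N}x^{n(\pi)}y^{h(\pi)}p^{w(\pi)}q^{a(\pi)}$ satisfies $$G_N(x,y,p,q)=\sum_{h=0}^{N}x^hy^hq^{h^2}\,\frac{R_{h-1}(p^2x;p,q)}{R_h(x;p,q)}.$$
   Context: A Dyck path is a lattice path starting at $(0,0)$, with steps $U=(1,1)$ and $D=(1,-1)$, ending on the line $y=0$ and never visiting a vertex with negative $y$-coordinate; $\mathcal D$ is the set of all Dyck paths (including the empty path). For $\pi\in\mathcal D$ with $2n$ steps, $n(\pi)=n$ is the semi-length; the height $h(\pi)$ is the maximum $y$-coordinate; the proper area $a(\pi)$ is the sum of the starting heights of all steps. Water capacity $w(\pi)$: let $h=h(\pi)$. For each $1\le k\le h$ mark the first up-step $U_k$ of $\pi$ from level $k-1$ to $k$ and the last down-step $D_k$ from level $k$ to $k-1$; they occur in the order $U_1,\dots,U_h,D_h,\dots,D_1$. The portions of $\pi$ strictly between consecutive marked steps are the gaps: for $1\le k<h$ a left gap at level $k$ (between $U_k$ and $U_{k+1}$) and a right gap at level $k$ (between $D_{k+1}$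 and $D_k$), and a single top gap at level $h$ (between $U_h$ and $D_h$). A gap at level $k$ starts and ends at height $k$ and never rises above height $k$; reflecting it in the line $y=k$ and translating to the horizontal axis gives a Dyck path of height at most $k$. Then $w(\pi)$ is the sum over all gaps of the proper areas of these reflected Dyck paths (and $w=0$ for the empty path). For $h\ge0$, $P_h(X,Q)=\sum_{m=0}^{\lfloor h/2\rfloor}(-X)^mQ^{m(m-1)}\begin{bmatrix} h-m \\ m \end{bmatrix}_Q$, where $\begin{bmatrix} N \\ m \end{bmatrix}_Q$ is the Gaussian binomial polynomial in $Q$ (so $P_0=P_1=1$). Identities involving $G_N$ are identities of formal power series in $x$. -}

module Defs where

open import Algebra.Apartness.Bundles using (HeytingCommutativeRing; HeytingField)
open import Algebra.Bundles using (CommutativeRing; RawRing)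
import Algebra.Definitions.RawSemiring as RawSemiringDefinitions
import Algebra.Apartness.Properties.HeytingCommutativeRing as HeytingProperties
open import Data.Fin.Base using (toℕ)
open import Data.Integer.Base as ℤ using (ℤ)
open import Data.List.Base using (List; []; _∷_; _++_; map; filter; foldr; length; take; drop; takeWhile; reverse; upTo; concatMap)
open import Data.Nat.Base as ℕ using (ℕ; zero; suc; pred; _∸_; _⊔_; ⌊_/2⌋)
open import Data.Nat.ListAction using (sum)
import Data.Nat.Properties as ℕₚ
open import Data.Product.Base using (_×_; _,_; proj₁; proj₂; ∃)
open import Data.Product.Properties using (≡-dec)
open import Function.Base using (_∘_)
import Level as L
open import Relation.Binary.Definitions using (DecidableEquality)
open import Relation.Binary.PropositionalEquality.Core using (refl)
open import Relation.Nullary.Decidable using (Dec; yes; no; ¬?; map′)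
import Relation.Binary.Reasoning.Setoid as ≈-Reasoning

------------------------------------------------------------------------
-- Dyck paths

data Step : Set where
  U D : Step

_≟-Step_ : DecidableEquality Step
U ≟-Step U = yes refl
U ≟-Step D = no λ ()
D ≟-Step U = no λ ()
D ≟-Step D = yes refl

Path : Set
Path = List Step

-- DyckFrom y π: started at height y, the path π ends at height 0 and
-- visits no vertex of negative height.
data DyckFrom : ℕ → Path → Set where
  []   : DyckFrom 0 []
  up   : ∀ {y π} → DyckFrom (suc y) π → DyckFrom y (U ∷ π)
  down : ∀ {y π} → DyckFrom y π → DyckFrom (suc y) (D ∷ π)

dyckFrom? : ∀ y π → Dec (DyckFrom y π)
dyckFrom? zero    []      = yes []
dyckFrom? (suc y) []      = no λ ()
dyckFrom? y       (U ∷ π) = map′ up (λ { (up d) → d }) (dyckFrom? (suc y) π)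
dyckFrom? zero    (D ∷ π) = no λ ()
dyckFrom? (suc y) (D ∷ π) = map′ down (λ { (down d) → d }) (dyckFrom? y π)

words : ℕ → List Path
words zero    = [] ∷ []
words (suc n) = map (U ∷_) (words n) ++ map (D ∷_) (words n)

-- The Dyck paths of semi-length n, each exactly once.
dyckPaths : ℕ → List Path
dyckPaths n = filter (dyckFrom? 0) (words (2 ℕ.* n))

-- The steps of a path started at height y, each with its starting height.
-- (The truncation in pred is never reached on a Dyck path.)
located : ℕ → Path → List (Step × ℕ)
located y []      = []
located y (U ∷ π) = (U , y) ∷ located (suc y) π
located y (D ∷ π) = (D , y) ∷ located (pred y) π

startHeights : Path → List ℕ
startHeights = map proj₂ ∘ located 0

-- The final vertex of a Dyck path has height 0, so the maximum over the
-- starting points of the steps is the maximum over all vertices.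
height : Path → ℕ
height = foldr _⊔_ 0 ∘ startHeights

properArea : Path → ℕ
properArea = sum ∘ startHeights

------------------------------------------------------------------------
-- Water capacity

_≟-located_ : DecidableEquality (Step × ℕ)
_≟-located_ = ≡-dec _≟-Step_ ℕₚ._≟_

-- Positions (counted from 0) of the marked steps U_k and D_k, for
-- 1 ≤ k ≤ height π: the first up-step from level k - 1 to k and the last
-- down-step from level k to k - 1.
posU posD : ℕ → Path → ℕ
posU k π = length (takeWhile (λ s → ¬? (s ≟-located (U , k ∸ 1))) (located 0 π))
posD k π = length π ∸ suc (length (takeWhile (λ s → ¬? (s ≟-located (D , k))) (reverse (located 0 π))))

-- The steps strictly between positions i and j.
between : ℕ → ℕ → Path → Path
between i j π = drop (suc i) (take j π)

leftGap rightGap topGap : ℕ → Path → Path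
leftGap  k π = between (posU k π) (posU (suc k) π) π
rightGap k π = between (posD (suc k) π) (posD k π) π
topGap   h π = between (posU h π) (posD h π) π

gapsOfHeight : ℕ → Path → List Path
gapsOfHeight zero    π = []
gapsOfHeight (suc h) π =
  topGap (suc h) π ∷
  concatMap (λ i → leftGap (suc i) π ∷ rightGap (suc i) π ∷ []) (upTo h)

gaps : Path → List Path
gaps π = gapsOfHeight (height π) π

flip-step : Step → Step
flip-step U = D
flip-step D = U

-- Reflection in a horizontal line.  No translation is needed afterwards,
-- since properArea always starts its argument at height 0.
reflect : Path → Path
reflect = map flip-step

waterCapacity : Path → ℕ
waterCapacity π = sum (map (properArea ∘ reflect) (gaps π))

------------------------------------------------------------------------
-- The polynomials P

module Polynomials {a ℓ} (A : RawRing a ℓ) where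

  open RawRing A
  open RawSemiringDefinitions rawSemiring using (_^_) renaming (sum to Σ[])

  -- The Gaussian binomial polynomial [N, m] evaluated at Q, by the q-Pascal
  -- rule [N+1, m+1] = [N, m] + Q^(m+1) [N, m+1].  The quotient of
  -- Q-factorials is not usable here: Q may be a root of unity.
  gaussBinomial : ℕ → ℕ → Carrier → Carrier
  gaussBinomial N       zero    Q = 1#
  gaussBinomial zero    (suc m) Q = 0#
  gaussBinomial (suc N) (suc m) Q =
    gaussBinomial N m Q + Q ^ suc m * gaussBinomial N (suc m) Q

  P : ℕ → Carrier → Carrier → Carrier
  P h X Q = Σ[] {suc ⌊ h /2⌋} λ i → let m = toℕ i in
    (- X) ^ m * Q ^ (m ℕ.* (m ∸ 1)) * gaussBinomial (h ∸ m) m Q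

------------------------------------------------------------------------
-- Formal power series in one variable x over a field

module DyckSeries {c ℓ₁ ℓ₂} (K : HeytingField c ℓ₁ ℓ₂) where

  open HeytingField K
  open CommutativeRing (HeytingCommutativeRing.commutativeRing heytingCommutativeRing)
    using (rawRing)
  open HeytingProperties heytingCommutativeRing using (x-0≈x; invertibleʳ⇒#; #-congʳ)
  open RawSemiringDefinitions (RawRing.rawSemiring rawRing) public
    using (_^_) renaming (sum to sumᴷ)

  -- The n-th value is the coefficient of x^n.
  Series : Set c
  Series = ℕ → Carrier

  const : Carrier → Series
  const a zero    = a
  const a (suc n) = 0#

  𝕩 : Series
  𝕩 zero          = 0#
  𝕩 (suc zero)    = 1#
  𝕩 (suc (suc n)) = 0#

  seriesRawRing : RawRing c ℓ₁
  seriesRawRing = record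
    { Carrier = Series
    ; _≈_     = λ f g → ∀ n → f n ≈ g n
    ; _+_     = λ f g n → f n + g n
    ; _*_     = λ f g n → sumᴷ {suc n} λ i → f (toℕ i) * g (n ∸ toℕ i)
    ; -_      = λ f n → - f n
    ; 0#      = const 0#
    ; 1#      = const 1#
    }

  open RawRing seriesRawRing public
    using ()
    renaming (_≈_ to _≈ˢ_; _+_ to _+ˢ_; _*_ to _*ˢ_; -_ to -ˢ_; 0# to 0ˢ; 1# to 1ˢ)
  open RawSemiringDefinitions (RawRing.rawSemiring seriesRawRing) public
    using () renaming (_^_ to _^ˢ_; sum to sumˢ; product to productˢ)
  open Polynomials seriesRawRing public using (P)

  infixl 7 _/ˢ_

  -- The reciprocal of a series g with constant coefficient 1 is the geometric
  -- series Σ_j (1 - g)^j, whose terms with j > n do not contribute to the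
  -- coefficient of x^n.  Only meaningful for such g.
  recipˢ : Series → Series
  recipˢ g n = sumᴷ {suc n} λ j → ((1ˢ +ˢ -ˢ g) ^ˢ toℕ j) n

  _/ˢ_ : Series → Series → Series
  f /ˢ g = f *ˢ recipˢ g

  ----------------------------------------------------------------------
  -- Nonzero elements of K and their integer powers

  Nonzero : Set (c L.⊔ ℓ₂)
  Nonzero = ∃ λ a → a # 0#

  infix  8 _⁻¹
  infixr 8 _^ℤ_

  _⁻¹ : Nonzero → Carrier
  (a , a#0) ⁻¹ = proj₁ (#⇒invertible a#0)

  _^ℤ_ : Nonzero → ℤ → Carrier
  a ^ℤ (ℤ.+ n)    = proj₁ a ^ n
  a ^ℤ ℤ.-[1+ n ] = (a ⁻¹) ^ suc n

  factorˡ-#0 : ∀ {a b} → a * b # 0# → a # 0#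
  factorˡ-#0 {a} {b} ab#0 =
    let (c , _ , ab-0*c≈1) = #⇒invertible ab#0 in
    invertibleʳ⇒# (b * c , (begin
      (a - 0#) * (b * c)  ≈⟨ *-congʳ (x-0≈x a) ⟩
      a * (b * c)         ≈⟨ *-assoc a b c ⟨
      a * b * c           ≈⟨ *-congʳ (x-0≈x (a * b)) ⟨
      (a * b - 0#) * c    ≈⟨ ab-0*c≈1 ⟩
      1#                  ∎))
    where open ≈-Reasoning setoid

  factorʳ-#0 : ∀ {a b} → a * b # 0# → b # 0#
  factorʳ-#0 {a} {b} ab#0 = factorˡ-#0 (#-congʳ (*-comm a b) ab#0)

  ----------------------------------------------------------------------
  -- The series R

  -- P_h (q^e p x , p²/q²)
  evalP : (h : ℕ) (e : ℤ) (x : Series) (p q : Nonzero) → Series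
  evalP h e x p q =
    P h (const (q ^ℤ e * proj₁ p) *ˢ x) (const (proj₁ p ^ 2 * (q ⁻¹) ^ 2))

  R : (h : ℕ) (x : Series) (p q : Nonzero) → Series
  R h x p q =
    productˢ {suc h} (λ i → let k = toℕ i in
      evalP k (ℤ.+ (2 ℕ.* k) ℤ.- ℤ.+ 3) x p q ^ˢ 2)
    *ˢ evalP (suc h) (ℤ.+ (2 ℕ.* h) ℤ.- ℤ.+ 1) x p q

  -- R-pred h is R_{h-1}, where R_{-1} = 1.
  R-pred : (h : ℕ) (x : Series) (p q : Nonzero) → Series
  R-pred zero    x p q = 1ˢ
  R-pred (suc h) x p q = R h x p q

  ----------------------------------------------------------------------
  -- The height-truncated generating function

  G : (N : ℕ) (y p q : Carrier) → Series
  G N y p q n = foldr _+_ 0# (map weight (filter (λ π → height π ℕₚ.≤? N) (dyckPaths n)))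
    where
    weight : Path → Carrier
    weight π = y ^ height π * p ^ waterCapacity π * q ^ properArea π

{-# OPTIONS --safe #-}

-- Reading a path with its running maximum M and its future maximum k, the water
-- above a vertex at height y is min(M, k) − y, so the water capacity is a sum
-- over the steps, and the path sums with given M, k and y satisfy a linear
-- system.  For fixed M and k this system is tridiagonal in y; eliminating from
-- the bottom, its minors are values of P, since P is the continuant with
-- P_{n+2}(X) = P_{n+1}(QX) − X P_n(Q²X).  Each gap at level k thus contributes
-- b_k(p²x) / b_{k+1}(x), where b_k(x) = P_k(q^{2k−3}px, p²/q²), and the product
-- over the 2h − 1 gaps of a path of height h telescopes to R_{h−1}(p²x) / R_h(x).
-- Reading the continuants backwards exchanges p and q, hence the symmetry of R.

module Submission where

open import Defs
open import Algebra.Apartness.Bundles using (HeytingField; HeytingCommutativeRing)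
open import Algebra.Bundles using (CommutativeRing; RawRing)
import Algebra.Definitions.RawSemiring as RawSemiringDefinitions
import Algebra.Properties.CommutativeSemiring.Exp as Exp
import Algebra.Properties.Ring as RingProperties
import Algebra.Properties.Semiring.Exp as SemiringExp
import Algebra.Properties.Semiring.Sum as SemiringSum
import Algebra.Solver.Ring.NaturalCoefficients.Default as Solver
open import Data.Fin.Base as Fin using (Fin; toℕ)
import Data.Fin.Properties as Finₚ
open import Data.Integer.Base as ℤ using (ℤ)
import Data.Integer.Properties as ℤₚ
open import Data.List.Base using (List; []; _∷_; _++_; _∷ʳ_; _ʳ++_; map; filter; foldr; length; take; drop; takeWhile; reverse; upTo; concatMap)
import Data.List.Properties as Listₚ
open import Data.List.Relation.Unary.All as All using (All; []; _∷_)
import Data.List.Relation.Unary.All.Properties as Allₚ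
open import Data.Nat.Base as ℕ using (ℕ; zero; suc; pred; _∸_; _⊔_; _⊓_; ⌊_/2⌋; z≤n; s≤s)
import Data.Nat.ListAction.Properties as ListActionₚ
import Data.Nat.Properties as ℕₚ
open import Data.Nat.Tactic.RingSolver using (solve-∀)
open import Data.Product.Base using (Σ; _×_; _,_; proj₁; proj₂; ∃)
open import Data.Sum.Base using (_⊎_; inj₁; inj₂)
open import Function.Base using (_∘_)
import Relation.Binary.Reasoning.Setoid as ≈-Reasoning
open import Relation.Binary.PropositionalEquality as ≡ using (_≡_; _≢_)
open import Relation.Nullary using (Dec; yes; no; ¬_; contradiction)
open import Relation.Nullary.Decidable using (¬?; _×-dec_)

-- An up-step from y to y + 1 and a down-step back, inside a gap at level k, together weigh
-- p^(2(k-y)-1) q^(2y+1) x. For the highest such pair, y = k - 1, this is q^(2k-1) p x, and each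
-- level further down multiplies it by p²/q²; this is the origin of both arguments of P. When the
-- unknown at level k is found as in Cramer's rule, the denominator involves all k pairs, while the
-- numerator lacks the highest one and starts at q^(2k-3) p³ x: hence its evaluation at p²x. The
-- starting points of marked steps lie under no water; their heights 0, ..., h-1 and h, ..., 1 give
-- q^(h²), and the up-steps among them give x^h.
--
-- No minor is ever inverted. Each gap is recorded as an equation between products, these equations
-- are multiplied along the path, and the only division is the final one by R_h, which is legitimate
-- because R_h has constant coefficient 1.

-- Recurrences of the continuant P, and tridiagonal elimination.

module PolynomialProperties {a ℓ} (A : CommutativeRing a ℓ) where

  open CommutativeRing A
  open Polynomials rawRing
  open Exp commutativeSemiring using (^-distrib-*)
  open SemiringExp semiring
  open SemiringSum semiring using (sum; sum-cong-≋; ∑-distrib-+; *-distribˡ-sum)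
  open RingProperties ring
  open Solver commutativeSemiring using (solve; _:=_; _:+_; _:*_)
  open ≈-Reasoning setoid

  sum-vanishing : ∀ n (f : ℕ → Carrier) → (∀ m → f m ≈ 0#) → sum {n} (f ∘ toℕ) ≈ 0#
  sum-vanishing zero    f f≈0 = refl
  sum-vanishing (suc n) f f≈0 =
    trans (+-cong (f≈0 0) (sum-vanishing n (f ∘ suc) (f≈0 ∘ suc))) (+-identityˡ 0#)

  sum-extend : ∀ {k n} (f : ℕ → Carrier) → k ℕ.≤ n → (∀ m → k ℕ.≤ m → f m ≈ 0#) →
    sum {k} (f ∘ toℕ) ≈ sum {n} (f ∘ toℕ)
  sum-extend {n = n} f z≤n f≈0 = sym (sum-vanishing n f λ m → f≈0 m z≤n)
  sum-extend f (s≤s k≤n) f≈0 =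
    +-congˡ (sum-extend (f ∘ suc) k≤n λ m k≤m → f≈0 (suc m) (s≤s k≤m))

  gaussBinomial-zero : ∀ {N m} Q → N ℕ.< m → gaussBinomial N m Q ≈ 0#
  gaussBinomial-zero {zero}  {suc m} Q _         = refl
  gaussBinomial-zero {suc N} {suc m} Q (s≤s N<m) = begin
    gaussBinomial N m Q + Q ^ suc m * gaussBinomial N (suc m) Q
      ≈⟨ +-cong (gaussBinomial-zero Q N<m)
           (*-congˡ (gaussBinomial-zero Q (ℕₚ.<-trans N<m (ℕₚ.n<1+n m)))) ⟩
    0# + Q ^ suc m * 0#  ≈⟨ +-identityˡ _ ⟩
    Q ^ suc m * 0#       ≈⟨ zeroʳ _ ⟩
    0#                   ∎

  term : ℕ → Carrier → Carrier → ℕ → Carrier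
  term h X Q m = (- X) ^ m * Q ^ (m ℕ.* (m ∸ 1)) * gaussBinomial (h ∸ m) m Q

  n≤2⌊n/2⌋+1 : ∀ n → n ℕ.≤ ⌊ n /2⌋ ℕ.+ suc ⌊ n /2⌋
  n≤2⌊n/2⌋+1 zero          = z≤n
  n≤2⌊n/2⌋+1 (suc zero)    = s≤s z≤n
  n≤2⌊n/2⌋+1 (suc (suc n)) =
    s≤s (ℕₚ.≤-trans (s≤s (n≤2⌊n/2⌋+1 n)) (ℕₚ.≤-reflexive (≡.sym (ℕₚ.+-suc ⌊ n /2⌋ _))))

  term-vanishing : ∀ h X Q m → ⌊ h /2⌋ ℕ.< m → term h X Q m ≈ 0#
  term-vanishing h X Q m@(suc _) h/2<m = trans (*-congˡ (gaussBinomial-zero Q h∸m<m)) (zeroʳ _)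
    where
    h<m+m : h ℕ.< m ℕ.+ m
    h<m+m = ℕₚ.≤-<-trans (n≤2⌊n/2⌋+1 h) (ℕₚ.+-mono-<-≤ h/2<m h/2<m)
    h∸m<m : h ∸ m ℕ.< m
    h∸m<m = ℕₚ.m<n+o⇒m∸n<o h m h<m+m

  -- The recurrences compare sums of different lengths, since ⌊h/2⌋ grows only at every second `h`.
  -- Longer sums are harmless: beyond ⌊h/2⌋ the Gaussian binomial has a lower index exceeding the
  -- upper one.
  P-extend : ∀ h X Q {n} → ⌊ h /2⌋ ℕ.< n → P h X Q ≈ sum {n} (term h X Q ∘ toℕ)
  P-extend h X Q h/2<n = sum-extend (term h X Q) h/2<n (term-vanishing h X Q)

  gaussBinomial-cong : ∀ N m {Q Q′} → Q ≈ Q′ → gaussBinomial N m Q ≈ gaussBinomial N m Q′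
  gaussBinomial-cong N       zero    Q≈Q′ = refl
  gaussBinomial-cong zero    (suc m) Q≈Q′ = refl
  gaussBinomial-cong (suc N) (suc m) Q≈Q′ =
    +-cong (gaussBinomial-cong N m Q≈Q′)
      (*-cong (^-congˡ (suc m) Q≈Q′) (gaussBinomial-cong N (suc m) Q≈Q′))

  P-cong : ∀ h {X X′ Q Q′} → X ≈ X′ → Q ≈ Q′ → P h X Q ≈ P h X′ Q′
  P-cong h X≈X′ Q≈Q′ = sum-cong-≋ {suc ⌊ h /2⌋} λ i → let m = toℕ i in
    *-cong (*-cong (^-congˡ m (-‿cong X≈X′)) (^-congˡ (m ℕ.* (m ∸ 1)) Q≈Q′))
      (gaussBinomial-cong (h ∸ m) m Q≈Q′)

  P-1 : ∀ X Q → P 1 X Q ≈ 1#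
  P-1 X Q = trans (+-identityʳ _) (trans (*-identityʳ _) (*-identityʳ _))

  P-0 : ∀ X Q → P 0 X Q ≈ 1#
  P-0 = P-1

  [m+1]m : ∀ m → suc m ℕ.* m ≡ m ℕ.* (m ∸ 1) ℕ.+ (m ℕ.+ m)
  [m+1]m zero    = ≡.refl
  [m+1]m (suc m) = lemma m
    where
    lemma : ∀ m → suc (suc m) ℕ.* suc m ≡ suc m ℕ.* m ℕ.+ (suc m ℕ.+ suc m)
    lemma = solve-∀

  -- The two summands of the q-Pascal rule correspond to choosing or not choosing the first entry
  -- `X` of the continuant. The powers of `Q` match because (m+1)m = m(m-1) + 2m, and the extra
  -- Q^(2m) turns X^m into (Q²X)^m. The bound on `m` keeps the truncated subtraction exact.
  term-suc : ∀ h X Q m → m ℕ.≤ h →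
    term (suc (suc h)) X Q (suc m)
      ≈ - X * term h (Q * (Q * X)) Q m + term (suc h) (Q * X) Q (suc m)
  term-suc h X Q m m≤h rewrite ℕₚ.+-∸-assoc 1 m≤h = begin
    - X * (- X) ^ m * Q ^ (suc m ℕ.* m) * (g₁ + Q ^ suc m * g₂)
      ≈⟨ *-congʳ (*-congˡ exponent) ⟩
    - X * (- X) ^ m * (e * (Q ^ m * Q ^ m)) * (g₁ + Q ^ suc m * g₂)
      ≈⟨ solve 7 (λ x y e q s u v →
           x :* y :* (e :* (q :* q)) :* (u :+ s :* v)
             := x :* (q :* (q :* y) :* e :* u) :+ s :* (x :* y) :* (e :* (q :* q)) :* v)
           refl (- X) ((- X) ^ m) e (Q ^ m) (Q ^ suc m) g₁ g₂ ⟩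
    - X * (Q ^ m * (Q ^ m * (- X) ^ m) * e * g₁)
      + Q ^ suc m * (- X) ^ suc m * (e * (Q ^ m * Q ^ m)) * g₂
      ≈⟨ +-cong (*-congˡ (*-congʳ (*-congʳ power₂))) (*-congʳ (*-cong (power₁ (suc m) X) (sym exponent))) ⟩
    - X * (((- (Q * (Q * X))) ^ m) * e * g₁)
      + (- (Q * X)) ^ suc m * Q ^ (suc m ℕ.* m) * g₂
      ∎
    where
    e = Q ^ (m ℕ.* (m ∸ 1))
    g₁ = gaussBinomial (h ∸ m) m Q
    g₂ = gaussBinomial (h ∸ m) (suc m) Q
    exponent : Q ^ (suc m ℕ.* m) ≈ e * (Q ^ m * Q ^ m)
    exponent = trans (^-congʳ Q ([m+1]m m))
      (trans (^-homo-* Q (m ℕ.* (m ∸ 1)) _) (*-congˡ (^-homo-* Q m m)))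
    power₁ : ∀ n Y → Q ^ n * (- Y) ^ n ≈ (- (Q * Y)) ^ n
    power₁ n Y = trans (sym (^-distrib-* Q (- Y) n)) (^-congˡ n (sym (-‿distribʳ-* Q Y)))
    power₂ : Q ^ m * (Q ^ m * (- X) ^ m) ≈ (- (Q * (Q * X))) ^ m
    power₂ = trans (*-congˡ (power₁ m X)) (power₁ m (Q * X))

  P-front : ∀ h X Q →
    P (suc (suc h)) X Q ≈ P (suc h) (Q * X) Q + - X * P h (Q * (Q * X)) Q
  P-front h X Q = begin
    1# * 1# * 1# + sum {suc n} (term (suc (suc h)) X Q ∘ suc ∘ toℕ)
      ≈⟨ +-congˡ (sum-cong-≋ {suc n} λ i → term-suc h X Q (toℕ i)
           (ℕₚ.≤-trans (ℕₚ.≤-pred (Finₚ.toℕ<n i)) (ℕₚ.⌊n/2⌋≤n h))) ⟩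
    1# * 1# * 1# + sum {suc n} (λ i → - X * t (toℕ i) + s (suc (toℕ i)))
      ≈⟨ +-congˡ (∑-distrib-+ {suc n} (λ i → - X * t (toℕ i)) (s ∘ suc ∘ toℕ)) ⟩
    1# * 1# * 1# + (sum {suc n} (λ i → - X * t (toℕ i)) + sum {suc n} (s ∘ suc ∘ toℕ))
      ≈⟨ +-congˡ (+-congʳ (*-distribˡ-sum {suc n} (- X) (t ∘ toℕ))) ⟨
    1# * 1# * 1# + (- X * P h (Q * (Q * X)) Q + sum {suc n} (s ∘ suc ∘ toℕ))
      ≈⟨ solve 3 (λ a b c → a :+ (b :+ c) := a :+ c :+ b) refl _ _ _ ⟩
    sum {suc (suc n)} (s ∘ toℕ) + - X * P h (Q * (Q * X)) Q
      ≈⟨ +-congʳ (P-extend (suc h) (Q * X) Q (s≤s (⌊1+h/2⌋≤ h))) ⟨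
    P (suc h) (Q * X) Q + - X * P h (Q * (Q * X)) Q ∎
    where
    n = ⌊ h /2⌋
    t = term h (Q * (Q * X)) Q
    s = term (suc h) (Q * X) Q
    ⌊1+h/2⌋≤ : ∀ h → ⌊ suc h /2⌋ ℕ.≤ suc ⌊ h /2⌋
    ⌊1+h/2⌋≤ h = ℕₚ.⌊n/2⌋-mono (ℕₚ.n≤1+n (suc h))

  -- The expansions at the first and at the last entry commute once these entries are not adjacent,
  -- that is, from three entries on. Thus `P-front`, induction and `P-front` backwards suffice, and
  -- one and two entries are the base cases.
  P-back : ∀ h X Q → P (suc (suc h)) X Q ≈ P (suc h) X Q + - (Q ^ h * X) * P h X Q
  P-back zero X Q = begin
    P 2 X Q                                    ≈⟨ P-front 0 X Q ⟩
    P 1 (Q * X) Q + - X * P 0 (Q * (Q * X)) Q  ≈⟨ +-cong (refl)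
                                                    (*-cong (-‿cong (sym (*-identityˡ X))) (refl)) ⟩
    P 1 X Q + - (1# * X) * P 0 X Q             ∎
  P-back (suc zero) X Q = begin
    P 3 X Q
      ≈⟨ P-front 1 X Q ⟩
    P 2 (Q * X) Q + - X * P 1 (Q * (Q * X)) Q
      ≈⟨ +-cong (P-front 0 (Q * X) Q) (*-congˡ refl) ⟩
    P 1 (Q * (Q * X)) Q + - (Q * X) * P 0 (Q * (Q * (Q * X))) Q + - X * P 0 (Q * (Q * X)) Q
      ≈⟨ solve 3 (λ a b c → a :+ b :+ c := a :+ c :+ b) refl _ _ _ ⟩
    P 1 (Q * (Q * X)) Q + - X * P 0 (Q * (Q * X)) Q + - (Q * X) * P 0 (Q * (Q * (Q * X))) Q
      ≈⟨ +-cong (+-congʳ (refl))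
           (*-cong (-‿cong (*-congʳ (sym (*-identityʳ Q)))) refl) ⟩
    P 1 (Q * X) Q + - X * P 0 (Q * (Q * X)) Q + - (Q * 1# * X) * P 1 X Q
      ≈⟨ +-congʳ (P-front 0 X Q) ⟨
    P 2 X Q + - (Q * 1# * X) * P 1 X Q ∎
  P-back (suc (suc h)) X Q = begin
    P (4 ℕ.+ h) X Q
      ≈⟨ P-front (suc (suc h)) X Q ⟩
    P (3 ℕ.+ h) (Q * X) Q + - X * P (2 ℕ.+ h) (Q * (Q * X)) Q
      ≈⟨ +-cong (P-back (suc h) (Q * X) Q) (*-congˡ (P-back h (Q * (Q * X)) Q)) ⟩
    P (2 ℕ.+ h) (Q * X) Q + - (Q ^ suc h * (Q * X)) * P (1 ℕ.+ h) (Q * X) Q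
      + - X * (P (1 ℕ.+ h) (Q * (Q * X)) Q + - (Q ^ h * (Q * (Q * X))) * P h (Q * (Q * X)) Q)
      ≈⟨ +-cong (+-congˡ (*-congʳ (-‿cong (solve 3 (λ q r x → q :* r :* (q :* x) := q :* (q :* r) :* x) refl Q (Q ^ h) X))))
           (*-congˡ (+-congˡ (*-congʳ (-‿cong (solve 3 (λ q r x → r :* (q :* (q :* x)) := q :* (q :* r) :* x) refl Q (Q ^ h) X))))) ⟩
    P (2 ℕ.+ h) (Q * X) Q + e * P (1 ℕ.+ h) (Q * X) Q
      + - X * (P (1 ℕ.+ h) (Q * (Q * X)) Q + e * P h (Q * (Q * X)) Q)
      ≈⟨ solve 6 (λ a e b x c d → a :+ e :* b :+ x :* (c :+ e :* d) := a :+ x :* c :+ e :* (b :+ x :* d))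
           refl _ e _ (- X) _ _ ⟩
    P (2 ℕ.+ h) (Q * X) Q + - X * P (1 ℕ.+ h) (Q * (Q * X)) Q
      + e * (P (1 ℕ.+ h) (Q * X) Q + - X * P h (Q * (Q * X)) Q)
      ≈⟨ +-cong (P-front (suc h) X Q) (*-congˡ (P-front h X Q)) ⟨
    P (3 ℕ.+ h) X Q + e * P (2 ℕ.+ h) X Q ∎
    where e = - (Q ^ suc (suc h) * X)

  -- P is a continuant; reading it backwards exchanges the first entry X and
  -- the last entry Q^h X, and inverts the ratio Q of consecutive entries.
  P-reverse : ∀ h {X X′ Q Q′} → Q * Q′ ≈ 1# → X′ ≈ Q ^ h * X →
    P (suc (suc h)) X Q ≈ P (suc (suc h)) X′ Q′
  P-reverse h {X} {X′} {Q} {Q′} QQ′≈1 X′≈ = proj₁ (both h X X′ X′≈)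
    where
    cancel : ∀ k {Y Y′} → Y′ ≈ Q ^ suc k * Y → Q′ * Y′ ≈ Q ^ k * Y
    cancel k {Y} {Y′} Y′≈ = begin
      Q′ * Y′                  ≈⟨ *-congˡ Y′≈ ⟩
      Q′ * (Q * Q ^ k * Y)     ≈⟨ solve 4 (λ a b c d → a :* (b :* c :* d) := b :* a :* (c :* d)) refl Q′ Q (Q ^ k) Y ⟩
      Q * Q′ * (Q ^ k * Y)     ≈⟨ *-congʳ QQ′≈1 ⟩
      1# * (Q ^ k * Y)         ≈⟨ *-identityˡ _ ⟩
      Q ^ k * Y                ∎
    step : ∀ k {Y Y′} → Y′ ≈ Q ^ k * Y →
      P (suc k) Y Q ≈ P (suc k) (Q′ * Y′) Q′ → P k Y Q ≈ P k (Q′ * (Q′ * Y′)) Q′ →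
      P (suc (suc k)) Y Q ≈ P (suc (suc k)) Y′ Q′
    step k {Y} {Y′} Y′≈ eq₁ eq₂ = begin
      P (suc (suc k)) Y Q                                            ≈⟨ P-back k Y Q ⟩
      P (suc k) Y Q + - (Q ^ k * Y) * P k Y Q                        ≈⟨ +-cong eq₁ (*-cong (-‿cong (sym Y′≈)) eq₂) ⟩
      P (suc k) (Q′ * Y′) Q′ + - Y′ * P k (Q′ * (Q′ * Y′)) Q′        ≈⟨ P-front k Y′ Q′ ⟨
      P (suc (suc k)) Y′ Q′                                          ∎
    -- Removing the last entry on one side is removing the first on the other, so each length rests
    -- on the two preceding ones and the induction carries a pair. Every removal multiplies the
    -- reversed first entry by `Q′`, hence the quantification over `Y″`.
    both : ∀ k Y Y′ → Y′ ≈ Q ^ k * Y →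
      (P (suc (suc k)) Y Q ≈ P (suc (suc k)) Y′ Q′) ×
      (∀ Y″ → Y″ ≈ Q ^ suc k * Y → P (suc (suc (suc k))) Y Q ≈ P (suc (suc (suc k))) Y″ Q′)
    both zero Y Y′ Y′≈ = P₂ , λ Y″ Y″≈ →
        step 1 Y″≈ (P₂′ Y″ Y″≈) refl
      where
      P₂ = step 0 Y′≈ refl refl
      P₂′ : ∀ Y″ → Y″ ≈ Q ^ 1 * Y → P 2 Y Q ≈ P 2 (Q′ * Y″) Q′
      P₂′ Y″ Y″≈ = step 0 (cancel 0 Y″≈) refl refl
    both (suc k) Y Y′ Y′≈ = third , λ Y″ Y″≈ →
        step (suc (suc k)) Y″≈
          (proj₂ (both k Y _ refl) _ (cancel (suc k) Y″≈))
          (proj₁ (both k Y _ (cancel k (cancel (suc k) Y″≈))))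
      where third = proj₂ (both k Y _ refl) Y′ Y′≈

  -- Gaussian elimination from the bottom of a tridiagonal system whose
  -- unknowns X y are coupled by ascents u y and descents d y.
  module Tridiagonal (u d X : ℕ → Carrier) where

    minor : ℕ → Carrier
    minor zero          = 1#
    minor (suc zero)    = 1#
    minor (suc (suc n)) = minor (suc n) + - (u n * d (suc n)) * minor n

    -- The equation `below`, multiplied by `d (suc n)`, cancels the coupling to `X n` against the
    -- subtracted term of the minor, without any division. `T` stands for whatever leaves the system
    -- at its top level.
    eliminate-top : ∀ n T →
      X n * minor (suc n) ≈ minor n * (u n * X (suc n)) →
      X (suc n) ≈ T + d (suc n) * X n →
      X (suc n) * minor (suc (suc n)) ≈ minor (suc n) * T
    eliminate-top n T below top = begin
      X (suc n) * (minor (suc n) + - (u n * d (suc n)) * minor n)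
        ≈⟨ distribˡ _ _ _ ⟩
      X (suc n) * minor (suc n) + X (suc n) * (- (u n * d (suc n)) * minor n)
        ≈⟨ +-congˡ (trans (*-congˡ (sym (-‿distribˡ-* _ _))) (sym (-‿distribʳ-* _ _))) ⟩
      X (suc n) * minor (suc n) + - (X (suc n) * (u n * d (suc n) * minor n))
        ≈⟨ +-cong (*-congʳ top) (-‿cong (solve 4 (λ x u d m → x :* (u :* d :* m) := d :* (m :* (u :* x))) refl _ _ _ _)) ⟩
      (T + d (suc n) * X n) * minor (suc n) + - (d (suc n) * (minor n * (u n * X (suc n))))
        ≈⟨ +-congˡ (-‿cong (*-congˡ below)) ⟨
      (T + d (suc n) * X n) * minor (suc n) + - (d (suc n) * (X n * minor (suc n)))
        ≈⟨ +-congʳ (solve 4 (λ t d x m → (t :+ d :* x) :* m := m :* t :+ d :* (x :* m)) refl _ _ _ _) ⟩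
      minor (suc n) * T + d (suc n) * (X n * minor (suc n)) + - (d (suc n) * (X n * minor (suc n)))
        ≈⟨ trans (+-assoc _ _ _) (trans (+-congˡ (-‿inverseʳ _)) (+-identityʳ _)) ⟩
      minor (suc n) * T ∎

    eliminate-bottom : ∀ T → X 0 ≈ T → X 0 * minor 1 ≈ minor 0 * T
    eliminate-bottom T X₀≈ = trans (*-identityʳ _) (trans X₀≈ (sym (*-identityˡ _)))

    eliminate-below : ∀ n → X 0 ≈ u 0 * X 1 →
      (∀ y → suc y ℕ.≤ n → X (suc y) ≈ u (suc y) * X (suc (suc y)) + d (suc y) * X y) →
      X n * minor (suc n) ≈ minor n * (u n * X (suc n))
    eliminate-below zero    bottom interior = eliminate-bottom _ bottom
    eliminate-below (suc n) bottom interior =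
      eliminate-top n _
        (eliminate-below n bottom λ y y<n → interior y (ℕₚ.m≤n⇒m≤1+n y<n))
        (interior n ℕₚ.≤-refl)

    -- Minors grow at the top, and by `ratio` the pairs further down arise from the top pair by
    -- powers of `Q`. The top pair is therefore the first entry of the continuant, and `P-front` is
    -- the matching recurrence. The smaller minor lacks this pair, hence its extra factor `Q`. For
    -- `n = 0` the entry is a default value; `P 0` and `P 1` equal 1.
    minor≈P : ∀ Q n → (∀ y → suc y ℕ.< n → u y * d (suc y) ≈ Q * (u (suc y) * d (suc (suc y)))) →
      (minor n ≈ P n (Q * (u (pred n) * d n)) Q) ×
      (minor (suc n) ≈ P (suc n) (u (pred n) * d n) Q)
    minor≈P Q zero    ratio = sym (P-0 Q Q) , sym (P-1 Q Q)
    minor≈P Q (suc zero) ratio =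
      sym (P-1 Q Q) ,
      sym (trans (P-front 0 _ Q) (+-cong (P-1 Q Q) (*-congˡ (P-0 Q Q))))
    minor≈P Q (suc (suc n)) ratio
      with p₁ , p₂ ← minor≈P Q (suc n) (λ y y<n → ratio y (ℕₚ.m≤n⇒m≤1+n y<n)) =
      trans p₂ (P-cong (suc (suc n)) e≈ refl) ,
      (begin
        minor (suc (suc n)) + - e * minor (suc n)
          ≈⟨ +-cong p₂ (*-congˡ p₁) ⟩
        P (suc (suc n)) (u n * d (suc n)) Q + - e * P (suc n) (Q * (u n * d (suc n))) Q
          ≈⟨ +-cong (P-cong (suc (suc n)) e≈ refl) (*-congˡ (P-cong (suc n) (*-congˡ e≈) refl)) ⟩
        P (suc (suc n)) (Q * e) Q + - e * P (suc n) (Q * (Q * e)) Q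
          ≈⟨ P-front (suc n) e Q ⟨
        P (suc (suc (suc n))) e Q ∎)
      where
      e = u (suc n) * d (suc (suc n))
      e≈ : u n * d (suc n) ≈ Q * e
      e≈ = ratio n ℕₚ.≤-refl

-- The ring of formal power series.

module SeriesProperties {c ℓ₁ ℓ₂} (K : HeytingField c ℓ₁ ℓ₂) where

  open HeytingField K using (heytingCommutativeRing)
  open DyckSeries K

  private module 𝕂 = CommutativeRing (HeytingCommutativeRing.commutativeRing heytingCommutativeRing)
  open 𝕂 hiding (rawRing)
  open SemiringSum semiring using (sum-cong-≋; ∑-distrib-+; *-distribˡ-sum)
  open Solver commutativeSemiring using (solve; _:=_; _:+_; _:*_)

  shift : Series → Series
  shift f = f ∘ suc

  *ˢ-cong : ∀ {f f′ g g′} → f ≈ˢ f′ → g ≈ˢ g′ → f *ˢ g ≈ˢ f′ *ˢ g′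
  *ˢ-cong f≈ g≈ n = sum-cong-≋ {suc n} λ i → *-cong (f≈ (toℕ i)) (g≈ (n ∸ toℕ i))

  *ˢ-congˡ : ∀ f {g g′} → g ≈ˢ g′ → f *ˢ g ≈ˢ f *ˢ g′
  *ˢ-congˡ f g≈ = *ˢ-cong {f} (λ _ → refl) g≈

  *ˢ-congʳ : ∀ g {f f′} → f ≈ˢ f′ → f *ˢ g ≈ˢ f′ *ˢ g
  *ˢ-congʳ g f≈ = *ˢ-cong {g = g} f≈ (λ _ → refl)

  *ˢ-congˡ-≤ : ∀ f {g g′} n → (∀ m → m ℕ.≤ n → g m ≈ g′ m) → (f *ˢ g) n ≈ (f *ˢ g′) n
  *ˢ-congˡ-≤ f n g≈ = sum-cong-≋ {suc n} λ i → *-congˡ {f (toℕ i)} (g≈ _ (ℕₚ.m∸n≤m n (toℕ i)))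

  -- The convolution unfolds at the lowest coefficient of its left factor; splitting it at the other
  -- end as well makes commutativity an induction.
  *ˢ-suc : ∀ f g n → (f *ˢ g) (suc n) ≈ (f *ˢ shift g) n + f (suc n) * g 0
  *ˢ-suc f g zero    = trans (+-congˡ (+-identityʳ _)) (+-congʳ (sym (+-identityʳ _)))
  *ˢ-suc f g (suc n) = trans (+-congˡ (*ˢ-suc (shift f) g n)) (sym (+-assoc _ _ _))

  *ˢ-comm : ∀ f g → f *ˢ g ≈ˢ g *ˢ f
  *ˢ-comm f g zero    = +-congʳ (*-comm (f 0) (g 0))
  *ˢ-comm f g (suc n) =
    trans (+-congˡ (*ˢ-comm (shift f) g n))
      (trans (+-comm _ _) (trans (+-congˡ (*-comm _ _)) (sym (*ˢ-suc g f n))))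

  *ˢ-distribʳ : ∀ h f g → (f +ˢ g) *ˢ h ≈ˢ (f *ˢ h) +ˢ (g *ˢ h)
  *ˢ-distribʳ h f g n =
    trans (sum-cong-≋ {suc n} λ i → distribʳ (h (n ∸ toℕ i)) (f (toℕ i)) (g (toℕ i)))
      (∑-distrib-+ {suc n} (λ i → f (toℕ i) * h (n ∸ toℕ i)) (λ i → g (toℕ i) * h (n ∸ toℕ i)))

  scale : Carrier → Series → Series
  scale a f n = a * f n

  scale-*ˢ : ∀ a f g → scale a f *ˢ g ≈ˢ scale a (f *ˢ g)
  scale-*ˢ a f g n =
    trans (sum-cong-≋ {suc n} λ i → *-assoc a (f (toℕ i)) (g (n ∸ toℕ i)))
      (sym (*-distribˡ-sum {suc n} a (λ i → f (toℕ i) * g (n ∸ toℕ i))))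

  *ˢ-assoc : ∀ f g h → (f *ˢ g) *ˢ h ≈ˢ f *ˢ (g *ˢ h)
  *ˢ-assoc f g h zero =
    +-congʳ (trans (*-congʳ (+-identityʳ _)) (trans (*-assoc _ _ _) (*-congˡ (sym (+-identityʳ _)))))
  *ˢ-assoc f g h (suc n) = begin
    (f 0 * g 0 + 0#) * h (suc n) + ((scale (f 0) (shift g) +ˢ (shift f *ˢ g)) *ˢ h) n
      ≈⟨ +-cong (*-congʳ (+-identityʳ _)) (*ˢ-distribʳ h (scale (f 0) (shift g)) (shift f *ˢ g) n) ⟩
    f 0 * g 0 * h (suc n) + ((scale (f 0) (shift g) *ˢ h) n + ((shift f *ˢ g) *ˢ h) n)
      ≈⟨ +-congˡ (+-cong (scale-*ˢ (f 0) (shift g) h n) (*ˢ-assoc (shift f) g h n)) ⟩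
    f 0 * g 0 * h (suc n) + (f 0 * (shift g *ˢ h) n + (shift f *ˢ (g *ˢ h)) n)
      ≈⟨ solve 5 (λ a b c d e → a :* b :* c :+ (a :* d :+ e) := a :* (b :* c :+ d) :+ e) refl _ _ _ _ _ ⟩
    f 0 * (g 0 * h (suc n) + (shift g *ˢ h) n) + (shift f *ˢ (g *ˢ h)) n ∎
    where open ≈-Reasoning setoid

  0ˢ≈0 : ∀ n → 0ˢ n ≈ 0#
  0ˢ≈0 zero    = refl
  0ˢ≈0 (suc n) = refl

  0ˢ*ˢ : ∀ g → 0ˢ *ˢ g ≈ˢ 0ˢ
  0ˢ*ˢ g zero    = trans (+-identityʳ _) (zeroˡ _)
  0ˢ*ˢ g (suc n) = trans (+-cong (zeroˡ _) (trans (*ˢ-congʳ g (sym ∘ 0ˢ≈0) n) (0ˢ*ˢ g n)))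
    (trans (+-identityˡ _) (0ˢ≈0 n))

  const-*ˢ : ∀ a f n → (const a *ˢ f) n ≈ a * f n
  const-*ˢ a f zero    = +-identityʳ _
  const-*ˢ a f (suc n) =
    trans (+-congˡ (trans (*ˢ-congʳ f (sym ∘ 0ˢ≈0) n) (trans (0ˢ*ˢ f n) (0ˢ≈0 n)))) (+-identityʳ _)

  1ˢ*ˢ : ∀ f → 1ˢ *ˢ f ≈ˢ f
  1ˢ*ˢ f n = trans (const-*ˢ 1# f n) (*-identityˡ _)

  𝕩*ˢ-suc : ∀ f n → (𝕩 *ˢ f) (suc n) ≈ f n
  𝕩*ˢ-suc f n = trans (+-cong (zeroˡ _) (*ˢ-congʳ f shift-𝕩 n)) (trans (+-identityˡ _) (1ˢ*ˢ f n))
    where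
    shift-𝕩 : shift 𝕩 ≈ˢ 1ˢ
    shift-𝕩 zero    = refl
    shift-𝕩 (suc _) = refl

  seriesRing : CommutativeRing c ℓ₁
  seriesRing = record
    { Carrier = Series
    ; _≈_ = _≈ˢ_
    ; _+_ = _+ˢ_
    ; _*_ = _*ˢ_
    ; -_ = -ˢ_
    ; 0# = 0ˢ
    ; 1# = 1ˢ
    ; isCommutativeRing = record
      { isRing = record
        { +-isAbelianGroup = record
          { isGroup = record
            { isMonoid = record
              { isSemigroup = record
                { isMagma = record
                  { isEquivalence = record
                    { refl = λ n → refl
                    ; sym = λ f≈g n → sym (f≈g n)
                    ; trans = λ f≈g g≈h n → trans (f≈g n) (g≈h n)
                    }
                  ; ∙-cong = λ f≈ g≈ n → +-cong (f≈ n) (g≈ n)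
                  }
                ; assoc = λ f g h n → +-assoc (f n) (g n) (h n)
                }
              ; identity = (λ f n → trans (+-congʳ (0ˢ≈0 n)) (+-identityˡ (f n)))
                         , (λ f n → trans (+-congˡ (0ˢ≈0 n)) (+-identityʳ (f n)))
              }
            ; inverse = (λ f n → trans (-‿inverseˡ (f n)) (sym (0ˢ≈0 n)))
                      , (λ f n → trans (-‿inverseʳ (f n)) (sym (0ˢ≈0 n)))
            ; ⁻¹-cong = λ f≈ n → -‿cong (f≈ n)
            }
          ; comm = λ f g n → +-comm (f n) (g n)
          }
        ; *-cong = *ˢ-cong
        ; *-assoc = *ˢ-assoc
        ; *-identity = 1ˢ*ˢ , (λ f n → trans (*ˢ-comm f 1ˢ n) (1ˢ*ˢ f n))
        ; distrib = (λ h f g n → trans (*ˢ-comm h (f +ˢ g) n)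
                       (trans (*ˢ-distribʳ h f g n) (+-cong (*ˢ-comm f h n) (*ˢ-comm g h n))))
                  , *ˢ-distribʳ
        }
      ; *-comm = *ˢ-comm
      }
    }

  private
    module 𝕊 = CommutativeRing seriesRing
    module 𝕊ₚ = RingProperties 𝕊.ring
  open PolynomialProperties seriesRing public
    using (P-cong; P-front; P-reverse; P-0; P-1; module Tridiagonal)

  const-cong : ∀ {a b} → a ≈ b → const a ≈ˢ const b
  const-cong a≈b zero    = a≈b
  const-cong a≈b (suc n) = refl

  const-* : ∀ a b → const (a * b) ≈ˢ const a *ˢ const b
  const-* a b n = trans (lemma n) (sym (const-*ˢ a (const b) n))
    where
    lemma : ∀ n → const (a * b) n ≈ a * const b n
    lemma zero    = refl
    lemma (suc n) = sym (zeroʳ a)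

  *ˢ-head : ∀ f g → (f *ˢ g) 0 ≈ f 0 * g 0
  *ˢ-head f g = +-identityʳ _

  ^ˢ-head : ∀ f n → f 0 ≈ 1# → (f ^ˢ n) 0 ≈ 1#
  ^ˢ-head f zero    f₀≈1 = refl
  ^ˢ-head f (suc n) f₀≈1 =
    trans (*ˢ-head f (f ^ˢ n)) (trans (*-cong f₀≈1 (^ˢ-head f n f₀≈1)) (*-identityˡ 1#))

  productˢ-head : ∀ n (F : Fin n → Series) → (∀ i → F i 0 ≈ 1#) → productˢ F 0 ≈ 1#
  productˢ-head zero    F F₀≈1 = refl
  productˢ-head (suc n) F F₀≈1 =
    trans (*ˢ-head (F Fin.zero) (productˢ (F ∘ Fin.suc)))
      (trans (*-cong (F₀≈1 Fin.zero) (productˢ-head n (F ∘ Fin.suc) (F₀≈1 ∘ Fin.suc))) (*-identityˡ 1#))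

  P-head : ∀ h X Q → X 0 ≈ 0# → P h X Q 0 ≈ 1#
  P-head h X Q X₀≈0 = proj₁ (both h X X₀≈0)
    where
    both : ∀ h X → X 0 ≈ 0# → (P h X Q 0 ≈ 1#) × (P (suc h) X Q 0 ≈ 1#)
    both zero    X X₀≈0 = P-0 X Q 0 , P-1 X Q 0
    both (suc h) X X₀≈0 = proj₂ (both h X X₀≈0) , (begin
      P (suc (suc h)) X Q 0
        ≈⟨ P-front h X Q 0 ⟩
      P (suc h) (Q *ˢ X) Q 0 + ((-ˢ X) *ˢ P h (Q *ˢ (Q *ˢ X)) Q) 0
        ≈⟨ +-cong (proj₂ (both h (Q *ˢ X) QX₀≈0)) (*ˢ-head (-ˢ X) (P h (Q *ˢ (Q *ˢ X)) Q)) ⟩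
      1# + - X 0 * P h (Q *ˢ (Q *ˢ X)) Q 0
        ≈⟨ +-congˡ (trans (*-congʳ (trans (-‿cong X₀≈0) -0#≈0#)) (zeroˡ _)) ⟩
      1# + 0#
        ≈⟨ +-identityʳ 1# ⟩
      1# ∎)
      where
      open ≈-Reasoning setoid
      open RingProperties ring using (-0#≈0#)
      QX₀≈0 : (Q *ˢ X) 0 ≈ 0#
      QX₀≈0 = trans (*ˢ-head Q X) (trans (*-congˡ X₀≈0) (zeroʳ _))

  sumˢ-coefficient : ∀ m (F : Fin m → Series) n → sumˢ F n ≈ sumᴷ (λ i → F i n)
  sumˢ-coefficient zero    F n = 0ˢ≈0 n
  sumˢ-coefficient (suc m) F n = +-congˡ (sumˢ-coefficient m (F ∘ Fin.suc) n)

  -- Reciprocals of series with constant coefficient 1.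

  module _ (g : Series) (g₀≈1 : g 0 ≈ 1#) where

    private
      u : Series
      u = 1ˢ +ˢ -ˢ g

      geometric : ℕ → Series
      geometric m = sumˢ {m} (λ j → u ^ˢ toℕ j)

    u^n-vanishing : ∀ n m → m ℕ.< n → (u ^ˢ n) m ≈ 0#
    u^n-vanishing (suc n) zero    _         =
      trans (*ˢ-head u (u ^ˢ n)) (trans (*-congʳ (trans (+-congˡ (-‿cong g₀≈1)) (-‿inverseʳ 1#))) (zeroˡ _))
    u^n-vanishing (suc n) (suc m) (s≤s m<n) = begin
      u 0 * (u ^ˢ n) (suc m) + (shift u *ˢ (u ^ˢ n)) m
        ≈⟨ +-cong (*-congʳ (trans (+-congˡ (-‿cong g₀≈1)) (-‿inverseʳ 1#)))
             (*ˢ-congˡ-≤ (shift u) m λ k k≤m → trans (u^n-vanishing n k (ℕₚ.≤-<-trans k≤m m<n)) (sym (0ˢ≈0 k))) ⟩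
      0# * (u ^ˢ n) (suc m) + (shift u *ˢ 0ˢ) m
        ≈⟨ +-cong (zeroˡ _) (trans (𝕊.zeroʳ (shift u) m) (0ˢ≈0 m)) ⟩
      0# + 0#
        ≈⟨ +-identityˡ 0# ⟩
      0# ∎
      where open ≈-Reasoning setoid

    geometric-suc : ∀ m → geometric (suc m) ≈ˢ 1ˢ +ˢ (u *ˢ geometric m)
    geometric-suc m = 𝕊.+-congˡ {1ˢ} {x = sumˢ {m} (λ j → u *ˢ (u ^ˢ toℕ j))} (𝕊.sym (*-distribˡ-sumˢ {m} u (λ j → u ^ˢ toℕ j)))
      where open SemiringSum 𝕊.semiring renaming (*-distribˡ-sum to *-distribˡ-sumˢ)

    geometric-last : ∀ m → geometric (suc m) ≈ˢ geometric m +ˢ (u ^ˢ m)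
    geometric-last zero    = 𝕊.trans {i = 1ˢ +ˢ 0ˢ} {1ˢ} (𝕊.+-identityʳ 1ˢ) (𝕊.sym (𝕊.+-identityˡ 1ˢ))
    geometric-last (suc m) = begin
      geometric (suc (suc m))                           ≈⟨ geometric-suc (suc m) ⟩
      1ˢ +ˢ (u *ˢ geometric (suc m))                    ≈⟨ 𝕊.+-congˡ {1ˢ} (*ˢ-congˡ u (geometric-last m)) ⟩
      1ˢ +ˢ (u *ˢ (geometric m +ˢ (u ^ˢ m)))            ≈⟨ 𝕊.+-congˡ {1ˢ} (𝕊.distribˡ u (geometric m) (u ^ˢ m)) ⟩
      1ˢ +ˢ ((u *ˢ geometric m) +ˢ (u ^ˢ suc m))        ≈⟨ 𝕊.+-assoc 1ˢ (u *ˢ geometric m) (u ^ˢ suc m) ⟨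
      (1ˢ +ˢ (u *ˢ geometric m)) +ˢ (u ^ˢ suc m)        ≈⟨ 𝕊.+-congʳ {u ^ˢ suc m} (geometric-suc m) ⟨
      geometric (suc m) +ˢ (u ^ˢ suc m)                 ∎
      where open ≈-Reasoning 𝕊.setoid

    -- `recipˢ` truncates the geometric series at a length depending on the coefficient. Below x^m
    -- one common length serves for all coefficients, so that identities between series become
    -- applicable.
    recipˢ-geometric : ∀ m n → n ℕ.< m → recipˢ g n ≈ geometric m n
    recipˢ-geometric (suc m) n (s≤s n≤m) with ℕₚ.m≤n⇒m<n∨m≡n n≤m
    ... | inj₂ ≡.refl = sym (sumˢ-coefficient (suc n) (λ j → u ^ˢ toℕ j) n)
    ... | inj₁ n<m    = begin
      recipˢ g n                       ≈⟨ recipˢ-geometric m n n<m ⟩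
      geometric m n                    ≈⟨ +-identityʳ _ ⟨
      geometric m n + 0#               ≈⟨ +-congˡ (u^n-vanishing m n n<m) ⟨
      geometric m n + (u ^ˢ m) n       ≈⟨ geometric-last m n ⟨
      geometric (suc m) n              ∎
      where open ≈-Reasoning setoid

    -- g = 1 − u, and g Σ_{j<m} u^j = 1 − u^m agrees with 1 below x^m.
    recipˢ-inverse : g *ˢ recipˢ g ≈ˢ 1ˢ
    recipˢ-inverse n = begin
      (g *ˢ recipˢ g) n
        ≈⟨ *ˢ-congˡ-≤ g n (λ m m≤n → recipˢ-geometric (suc n) m (s≤s m≤n)) ⟩
      (g *ˢ s) n
        ≈⟨ +-identityʳ _ ⟨
      (g *ˢ s) n + 0#
        ≈⟨ +-congˡ (u^n-vanishing (suc n) n ℕₚ.≤-refl) ⟨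
      (g *ˢ s) n + (u *ˢ (u ^ˢ n)) n
        ≈⟨ telescope n ⟩
      1ˢ n ∎
      where
      open ≈-Reasoning setoid
      s = geometric (suc n)
      telescope : (g *ˢ s) +ˢ (u ^ˢ suc n) ≈ˢ 1ˢ
      telescope = 𝕊ₚ.+-cancelʳ (u *ˢ s) _ _ λ k → begin
        (g *ˢ s) k + (u ^ˢ suc n) k + (u *ˢ s) k
          ≈⟨ solve 3 (λ a b c → a :+ b :+ c := a :+ c :+ b) refl _ _ _ ⟩
        (g *ˢ s) k + (u *ˢ s) k + (u ^ˢ suc n) k
          ≈⟨ +-congʳ (*ˢ-distribʳ s g u k) ⟨
        ((g +ˢ u) *ˢ s) k + (u ^ˢ suc n) k
          ≈⟨ +-congʳ (trans (*ˢ-congʳ s g+u≈1 k) (1ˢ*ˢ s k)) ⟩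
        s k + (u ^ˢ suc n) k
          ≈⟨ geometric-last (suc n) k ⟨
        geometric (suc (suc n)) k
          ≈⟨ geometric-suc (suc n) k ⟩
        1ˢ k + (u *ˢ s) k ∎
        where
        g+u≈1 : g +ˢ u ≈ˢ 1ˢ
        g+u≈1 k = trans (+-comm _ _) (trans (+-assoc _ _ _) (trans (+-congˡ (-‿inverseˡ _)) (+-identityʳ _)))

    quotient-unique : ∀ f f′ H → H *ˢ g ≈ˢ f *ˢ f′ → H ≈ˢ f *ˢ (f′ /ˢ g)
    quotient-unique f f′ H Hg≈ = begin
      H                          ≈⟨ 𝕊.*-identityʳ H ⟨
      H *ˢ 1ˢ                    ≈⟨ *ˢ-congˡ H recipˢ-inverse ⟨
      H *ˢ (g *ˢ recipˢ g)       ≈⟨ *ˢ-assoc H g (recipˢ g) ⟨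
      (H *ˢ g) *ˢ recipˢ g       ≈⟨ *ˢ-congʳ (recipˢ g) Hg≈ ⟩
      (f *ˢ f′) *ˢ recipˢ g      ≈⟨ *ˢ-assoc f f′ (recipˢ g) ⟩
      f *ˢ (f′ /ˢ g)             ∎
      where open ≈-Reasoning 𝕊.setoid

-- Water capacity as a sum over the steps.

module WaterCapacity where

  open import Data.Nat.ListAction using (sum)
  open ≡ using (refl; sym; trans; cong; cong₂; subst)
  open ≡.≡-Reasoning

  peak : ℕ → Path → ℕ
  peak y []      = y
  peak y (U ∷ π) = peak (suc y) π
  peak y (D ∷ π) = y ⊔ peak (pred y) π

  area : ℕ → Path → ℕ
  area y π = sum (map proj₂ (located y π))

  depth : ℕ → ℕ → Path → ℕ
  depth M y π = sum (map (λ s → M ∸ proj₂ s) (located y π))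

  -- A step contributes the water above its starting point; the level there is
  -- the smaller of the maxima before (M, updated along the path) and after it.
  water : ℕ → ℕ → Path → ℕ
  water M y []      = 0
  water M y (U ∷ π) = (M ⊓ peak (suc y) π ∸ y) ℕ.+ water (M ⊔ suc y) (suc y) π
  water M y (D ∷ π) = (M ⊓ peak y (D ∷ π) ∸ y) ℕ.+ water M (pred y) π

  data Below (M : ℕ) : ℕ → Path → ℕ → Set where
    []   : ∀ {y} → Below M y [] y
    up   : ∀ {y π z} → suc y ℕ.≤ M → Below M (suc y) π z → Below M y (U ∷ π) z
    down : ∀ {y π z} → Below M y π z → Below M (suc y) (D ∷ π) z

  y≤peak : ∀ y π → y ℕ.≤ peak y π
  y≤peak y []      = ℕₚ.≤-refl
  y≤peak y (U ∷ π) = ℕₚ.<⇒≤ (y≤peak (suc y) π)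
  y≤peak y (D ∷ π) = ℕₚ.m≤m⊔n y _

  height≡peak : ∀ {y π} → DyckFrom y π → foldr _⊔_ 0 (map proj₂ (located y π)) ≡ peak y π
  height≡peak []                   = refl
  height≡peak {y} {U ∷ π} (up d)   =
    trans (cong (y ⊔_) (height≡peak d)) (ℕₚ.m≤n⇒m⊔n≡n (ℕₚ.<⇒≤ (y≤peak (suc y) π)))
  height≡peak {y} (down d)         = cong (y ⊔_) (height≡peak d)

  starts≤peak : ∀ {y π} → DyckFrom y π → All (λ s → proj₂ s ℕ.≤ peak y π) (located y π)
  starts≤peak []                 = []
  starts≤peak {y} {U ∷ π} (up d) = ℕₚ.<⇒≤ (y≤peak (suc y) π) ∷ starts≤peak d
  starts≤peak {y} {D ∷ π} (down d) =
    ℕₚ.m≤m⊔n y (peak (pred y) π) ∷ All.map (λ s≤ → ℕₚ.≤-trans s≤ (ℕₚ.m≤n⊔m y _)) (starts≤peak d)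

  located-++ : ∀ {M y π z} ρ → Below M y π z → located y (π ++ ρ) ≡ located y π ++ located z ρ
  located-++ ρ []         = refl
  located-++ ρ (up _ b)   = cong (_ ∷_) (located-++ ρ b)
  located-++ ρ (down b)   = cong (_ ∷_) (located-++ ρ b)

  length-located : ∀ y π → length (located y π) ≡ length π
  length-located y []      = refl
  length-located y (U ∷ π) = cong suc (length-located (suc y) π)
  length-located y (D ∷ π) = cong suc (length-located (pred y) π)

  UpsBelow : ℕ → List (Step × ℕ) → Set
  UpsBelow M = All (λ s → proj₁ s ≡ U → proj₂ s ℕ.< M)

  Below⇒UpsBelow : ∀ {M y π z} → Below M y π z → UpsBelow M (located y π)
  Below⇒UpsBelow []         = []
  Below⇒UpsBelow (up y<M b) = (λ _ → y<M) ∷ Below⇒UpsBelow b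
  Below⇒UpsBelow (down b)   = (λ ()) ∷ Below⇒UpsBelow b

  area-reflect : ∀ {M y π z} → y ℕ.≤ M → Below M y π z → area (M ∸ y) (reflect π) ≡ depth M y π
  area-reflect y≤M []                   = refl
  area-reflect {M} {y} {U ∷ π} y≤M (up y<M b) = cong ((M ∸ y) ℕ.+_)
    (trans (cong (λ e → area e (reflect π)) (ℕₚ.pred[m∸n]≡m∸[1+n] M y)) (area-reflect y<M b))
  area-reflect {M} {suc y} {D ∷ π} y<M (down b) = cong ((M ∸ suc y) ℕ.+_)
    (trans (cong (λ e → area e (reflect π)) (sym (ℕₚ.+-∸-assoc 1 y<M))) (area-reflect (ℕₚ.<⇒≤ y<M) b))

  gapArea : Path → ℕ
  gapArea = properArea ∘ reflect

  gapArea≡depth : ∀ {M π z} → Below M M π z → gapArea π ≡ depth M M π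
  gapArea≡depth {M} {π} b =
    trans (cong (λ e → area e (reflect π)) (sym (ℕₚ.n∸n≡0 M))) (area-reflect ℕₚ.≤-refl b)

  -- The cut is at the marked up-step from level `M`. Up to there the running maximum is `M`, below
  -- the future maximum, so each step contributes its depth below `M`, and the marked step itself
  -- contributes 0.
  first-passage : ∀ {M y π} → DyckFrom y π → y ℕ.≤ M → M ℕ.< peak y π →
    ∃ λ γ → ∃ λ ρ → π ≡ γ ++ U ∷ ρ × Below M y γ M × DyckFrom (suc M) ρ ×
      peak (suc M) ρ ≡ peak y π × water M y π ≡ depth M y γ ℕ.+ water (suc M) (suc M) ρ
  first-passage {M} {y} {U ∷ π} (up d) y≤M M<peak with ℕₚ.m≤n⇒m<n∨m≡n y≤M
  ... | inj₂ refl = [] , π , refl , [] , d , refl , cong₂ ℕ._+_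
    (trans (cong (_∸ y) (ℕₚ.m≤n⇒m⊓n≡m (ℕₚ.<⇒≤ M<peak))) (ℕₚ.n∸n≡0 y))
    (cong (λ e → water e (suc y) π) (ℕₚ.m≤n⇒m⊔n≡n (ℕₚ.n≤1+n y)))
  ... | inj₁ y<M with γ , ρ , refl , b , d′ , pk , wt ← first-passage d y<M M<peak =
    U ∷ γ , ρ , refl , up y<M b , d′ , pk , (begin
      (M ⊓ peak (suc y) π ∸ y) ℕ.+ water (M ⊔ suc y) (suc y) π
        ≡⟨ cong₂ ℕ._+_ (cong (_∸ y) (ℕₚ.m≤n⇒m⊓n≡m (ℕₚ.<⇒≤ M<peak)))
             (cong (λ e → water e (suc y) π) (ℕₚ.m≥n⇒m⊔n≡m y<M)) ⟩
      (M ∸ y) ℕ.+ water M (suc y) π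
        ≡⟨ cong ((M ∸ y) ℕ.+_) wt ⟩
      (M ∸ y) ℕ.+ (depth M (suc y) γ ℕ.+ water (suc M) (suc M) ρ)
        ≡⟨ ℕₚ.+-assoc (M ∸ y) _ _ ⟨
      depth M y (U ∷ γ) ℕ.+ water (suc M) (suc M) ρ ∎)
  first-passage {M} {suc y} {D ∷ π} (down d) y<M M<peak
    with γ , ρ , refl , b , d′ , pk , wt ← first-passage d (ℕₚ.<⇒≤ y<M)
      (subst (M ℕ.<_) (ℕₚ.m≤n⇒m⊔n≡n (ℕₚ.≮⇒≥ λ peak<1+y → ℕₚ.<⇒≱ M<peak
        (ℕₚ.⊔-lub y<M (ℕₚ.≤-trans (ℕₚ.<⇒≤ peak<1+y) y<M)))) M<peak) =
    D ∷ γ , ρ , refl , down b , d′ , trans pk (sym (ℕₚ.m≤n⇒m⊔n≡n 1+y≤peak)) , (begin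
      (M ⊓ (suc y ⊔ peak y π) ∸ suc y) ℕ.+ water M y π
        ≡⟨ cong₂ ℕ._+_ (cong (_∸ suc y) (ℕₚ.m≤n⇒m⊓n≡m (ℕₚ.<⇒≤ M<peak))) wt ⟩
      (M ∸ suc y) ℕ.+ (depth M y γ ℕ.+ water (suc M) (suc M) ρ)
        ≡⟨ ℕₚ.+-assoc (M ∸ suc y) _ _ ⟨
      depth M (suc y) (D ∷ γ) ℕ.+ water (suc M) (suc M) ρ ∎)
    where
    1+y≤peak : suc y ℕ.≤ peak y π
    1+y≤peak = ℕₚ.≮⇒≥ λ peak<1+y → ℕₚ.<⇒≱ M<peak
      (ℕₚ.⊔-lub y<M (ℕₚ.≤-trans (ℕₚ.<⇒≤ peak<1+y) y<M))

  -- As long as the path still returns to level `suc j`, the future maximum `suc j` is the water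
  -- level. The cut is at the down-step after which this maximum drops; it drops to exactly `j`,
  -- because the rest of the path starts there.
  last-passage : ∀ {M j y π} → DyckFrom y π → suc j ℕ.≤ M → peak y π ≡ suc j →
    ∃ λ γ → ∃ λ ρ → π ≡ γ ++ D ∷ ρ × Below (suc j) y γ (suc j) × DyckFrom j ρ ×
      peak j ρ ≡ j × water M y π ≡ depth (suc j) y γ ℕ.+ water M j ρ
  last-passage {M} {j} {y} {U ∷ π} (up d) j<M pk≡
    with γ , ρ , refl , b , d′ , pk , wt ← last-passage d j<M pk≡ =
    U ∷ γ , ρ , refl , up y<1+j b , d′ , pk , (begin
      (M ⊓ peak (suc y) π ∸ y) ℕ.+ water (M ⊔ suc y) (suc y) π
        ≡⟨ cong₂ ℕ._+_ (cong (_∸ y) (trans (cong (M ⊓_) pk≡) (ℕₚ.m≥n⇒m⊓n≡n j<M)))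
             (cong (λ e → water e (suc y) π) (ℕₚ.m≥n⇒m⊔n≡m (ℕₚ.≤-trans y<1+j j<M))) ⟩
      (suc j ∸ y) ℕ.+ water M (suc y) π
        ≡⟨ cong ((suc j ∸ y) ℕ.+_) wt ⟩
      (suc j ∸ y) ℕ.+ (depth (suc j) (suc y) γ ℕ.+ water M j ρ)
        ≡⟨ ℕₚ.+-assoc (suc j ∸ y) _ _ ⟨
      depth (suc j) y (U ∷ γ) ℕ.+ water M j ρ ∎)
    where
    y<1+j : suc y ℕ.≤ suc j
    y<1+j = subst (suc y ℕ.≤_) pk≡ (y≤peak (suc y) π)
  last-passage {M} {j} {suc y} {D ∷ π} (down d) j<M pk≡ with peak y π ℕₚ.≟ suc j
  ... | yes pk′ with γ , ρ , refl , b , d′ , pk , wt ← last-passage d j<M pk′ =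
    D ∷ γ , ρ , refl , down b , d′ , pk , (begin
      (M ⊓ (suc y ⊔ peak y π) ∸ suc y) ℕ.+ water M y π
        ≡⟨ cong₂ ℕ._+_ (cong (_∸ suc y) (trans (cong (M ⊓_) pk≡) (ℕₚ.m≥n⇒m⊓n≡n j<M))) wt ⟩
      (suc j ∸ suc y) ℕ.+ (depth (suc j) y γ ℕ.+ water M j ρ)
        ≡⟨ ℕₚ.+-assoc (suc j ∸ suc y) _ _ ⟨
      depth (suc j) (suc y) (D ∷ γ) ℕ.+ water M j ρ ∎)
  ... | no pk≢ with ℕₚ.⊔-sel (suc y) (peak y π)
  ...   | inj₂ ⊔≡ = contradiction (trans (sym ⊔≡) pk≡) pk≢
  ...   | inj₁ ⊔≡ with refl ← ℕₚ.suc-injective (trans (sym ⊔≡) pk≡) =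
    [] , π , refl , [] , d ,
    ℕₚ.≤-antisym
      (ℕₚ.≤-pred (ℕₚ.≤∧≢⇒< (ℕₚ.≤-trans (ℕₚ.m≤n⊔m (suc y) _) (ℕₚ.≤-reflexive pk≡)) pk≢))
      (y≤peak y π) ,
    cong (ℕ._+ water M y π)
      (trans (cong (_∸ suc y) (trans (cong (M ⊓_) pk≡) (ℕₚ.m≥n⇒m⊓n≡n j<M))) (ℕₚ.n∸n≡0 (suc y)))

  takeWhile-before : ∀ t xs ys → All (_≢ t) xs →
    takeWhile (λ s → ¬? (s ≟-located t)) (xs ++ t ∷ ys) ≡ xs
  takeWhile-before t []       ys []           with t ≟-located t
  ... | yes _  = refl
  ... | no t≢t = contradiction refl t≢t
  takeWhile-before t (x ∷ xs) ys (x≢t ∷ xs≢t) with x ≟-located t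
  ... | yes x≡t = contradiction x≡t x≢t
  ... | no _    = cong (x ∷_) (takeWhile-before t xs ys xs≢t)

  All-ʳ++ : ∀ {A : Set} {P : A → Set} {xs ys} → All P xs → All P ys → All P (xs ʳ++ ys)
  All-ʳ++ []         pys = pys
  All-ʳ++ (px ∷ pxs) pys = All-ʳ++ pxs (px ∷ pys)

  posU-at : ∀ {k π xs ys} → located 0 π ≡ xs ++ (U , k) ∷ ys → UpsBelow k xs →
    posU (suc k) π ≡ length xs
  posU-at {k} {π} {xs} {ys} eq ups = cong length (trans (cong (takeWhile _) eq)
    (takeWhile-before (U , k) xs ys (All.map (λ { lt refl → ℕₚ.<-irrefl refl (lt refl) }) ups)))

  posD-at : ∀ {k π xs ys} → located 0 π ≡ xs ++ (D , k) ∷ ys → All (_≢ (D , k)) ys →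
    posD k π ≡ length xs
  posD-at {k} {π} {xs} {ys} eq ys≢ = begin
    length π ∸ suc (length (takeWhile _ (reverse (located 0 π))))
      ≡⟨ cong₂ (λ m zs → m ∸ suc (length (takeWhile _ zs)))
           (trans (sym (length-located 0 π)) (cong length eq)) reversed ⟩
    length (xs ++ (D , k) ∷ ys) ∸ suc (length (takeWhile _ (reverse ys ++ (D , k) ∷ reverse xs)))
      ≡⟨ cong₂ (λ m zs → m ∸ suc (length zs)) (Listₚ.length-++ xs)
           (takeWhile-before (D , k) (reverse ys) (reverse xs) (All-ʳ++ ys≢ [])) ⟩
    length xs ℕ.+ suc (length ys) ∸ suc (length (reverse ys))
      ≡⟨ cong (λ m → length xs ℕ.+ suc (length ys) ∸ suc m) (Listₚ.length-reverse ys) ⟩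
    length xs ℕ.+ suc (length ys) ∸ suc (length ys)
      ≡⟨ ℕₚ.m+n∸n≡m (length xs) (suc (length ys)) ⟩
    length xs ∎
    where
    reversed : reverse (located 0 π) ≡ reverse ys ++ (D , k) ∷ reverse xs
    reversed = trans (cong reverse eq) (trans (Listₚ.++-ʳ++ xs) (Listₚ.ʳ++-defn ys))

  between-++ : ∀ α γ ρ {i j π} → suc i ≡ length α → j ≡ length α ℕ.+ length γ →
    π ≡ α ++ γ ++ ρ → between i j π ≡ γ
  between-++ α γ ρ refl-i refl refl rewrite refl-i = drop-take α
    where
    take-++ : ∀ γ → take (length γ) (γ ++ ρ) ≡ γ
    take-++ []      = refl
    take-++ (s ∷ γ) = cong (s ∷_) (take-++ γ)
    drop-take : ∀ α → drop (length α) (take (length α ℕ.+ length γ) (α ++ γ ++ ρ)) ≡ γ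
    drop-take []      = take-++ γ
    drop-take (s ∷ α) = drop-take α

  total : (ℕ → ℕ) → ℕ → ℕ
  total f zero    = 0
  total f (suc n) = total f n ℕ.+ f n

  -- The list of gaps interleaves left and right gaps, whereas the path meets the left gaps upwards
  -- and then the right gaps downwards. Separate totals decouple the two orders.
  sum-gaps : ∀ (f : Path → ℕ) (l r : ℕ → Path) n →
    sum (map f (concatMap (λ i → l i ∷ r i ∷ []) (upTo n))) ≡ total (f ∘ l) n ℕ.+ total (f ∘ r) n
  sum-gaps f l r zero    = refl
  sum-gaps f l r (suc n) = begin
    sum (map f (concatMap pair (upTo (suc n))))
      ≡⟨ cong (λ is → sum (map f (concatMap pair is))) (Listₚ.upTo-∷ʳ n) ⟨
    sum (map f (concatMap pair (upTo n ∷ʳ n)))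
      ≡⟨ cong (sum ∘ map f) (Listₚ.concatMap-++ pair (upTo n) (n ∷ [])) ⟩
    sum (map f (concatMap pair (upTo n) ++ pair n ++ []))
      ≡⟨ cong sum (Listₚ.map-++ f (concatMap pair (upTo n)) (pair n ++ [])) ⟩
    sum (map f (concatMap pair (upTo n)) ++ map f (pair n ++ []))
      ≡⟨ ListActionₚ.sum-++ (map f (concatMap pair (upTo n))) (map f (pair n ++ [])) ⟩
    sum (map f (concatMap pair (upTo n))) ℕ.+ (f (l n) ℕ.+ (f (r n) ℕ.+ 0))
      ≡⟨ cong (ℕ._+ (f (l n) ℕ.+ (f (r n) ℕ.+ 0))) (sum-gaps f l r n) ⟩
    total (f ∘ l) n ℕ.+ total (f ∘ r) n ℕ.+ (f (l n) ℕ.+ (f (r n) ℕ.+ 0))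
      ≡⟨ rearrange (total (f ∘ l) n) (total (f ∘ r) n) (f (l n)) (f (r n)) ⟩
    total (f ∘ l) n ℕ.+ f (l n) ℕ.+ (total (f ∘ r) n ℕ.+ f (r n)) ∎
    where
    pair : ℕ → List Path
    pair i = l i ∷ r i ∷ []
    rearrange : ∀ a b c d → a ℕ.+ b ℕ.+ (c ℕ.+ (d ℕ.+ 0)) ≡ a ℕ.+ c ℕ.+ (b ℕ.+ d)
    rearrange = solve-∀

  -- Locating the marked steps along a path.

  module _ (π : Path) where

    leftArea rightArea : ℕ → ℕ
    leftArea  i = gapArea (leftGap (suc i) π)
    rightArea i = gapArea (rightGap (suc i) π)

    -- A position on π at height y: the part ρ after it, the part α before it,
    -- and the located steps xs of α.
    record Position (y : ℕ) (ρ : Path) : Set where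
      constructor position
      field
        {α} : Path
        {xs} : List (Step × ℕ)
        split   : π ≡ α ++ ρ
        starts  : located 0 π ≡ xs ++ located y ρ
        lengths : length xs ≡ length α

    open Position

    module _ {M y γ z s ρ} (p : Position y (γ ++ s ∷ ρ)) (b : Below M y γ z) where

      private
        gap-lengths : length (xs p ++ located y γ) ≡ length (α p ++ γ)
        gap-lengths = begin
          length (xs p ++ located y γ)                 ≡⟨ Listₚ.length-++ (xs p) ⟩
          length (xs p) ℕ.+ length (located y γ)       ≡⟨ cong₂ ℕ._+_ (lengths p) (length-located y γ) ⟩
          length (α p) ℕ.+ length γ                    ≡⟨ Listₚ.length-++ (α p) ⟨
          length (α p ++ γ)                            ∎

      gap-starts : located 0 π ≡ (xs p ++ located y γ) ++ located z (s ∷ ρ)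
      gap-starts = begin
        located 0 π                                          ≡⟨ starts p ⟩
        xs p ++ located y (γ ++ s ∷ ρ)                       ≡⟨ cong (xs p ++_) (located-++ (s ∷ ρ) b) ⟩
        xs p ++ (located y γ ++ located z (s ∷ ρ))           ≡⟨ Listₚ.++-assoc (xs p) _ _ ⟨
        (xs p ++ located y γ) ++ located z (s ∷ ρ)           ∎

      -- Giving the next height by an equation, which is `refl` for either kind of step, lets one
      -- construction serve marked up-steps and marked down-steps.
      advance : ∀ {y′} → located z (s ∷ ρ) ≡ (s , z) ∷ located y′ ρ → Position y′ ρ
      advance {y′} step = position {α = α p ++ γ ++ s ∷ []} {(xs p ++ located y γ) ++ (s , z) ∷ []}
        (trans (split p) (trans (cong (α p ++_) (sym (Listₚ.++-assoc γ _ ρ))) (sym (Listₚ.++-assoc (α p) _ ρ))))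
        (trans gap-starts (trans (cong ((xs p ++ located y γ) ++_) step) (sym (Listₚ.++-assoc (xs p ++ located y γ) _ _))))
        (trans (Listₚ.length-++ (xs p ++ located y γ)) (trans (cong (ℕ._+ 1) gap-lengths)
          (trans (sym (Listₚ.length-++ (α p ++ γ))) (cong length (Listₚ.++-assoc (α p) γ _)))))

      mark-length : ∀ {j} → j ≡ length (xs p ++ located y γ) → j ≡ length (α p) ℕ.+ length γ
      mark-length j≡ = trans j≡ (trans gap-lengths (Listₚ.length-++ (α p)))

      mark-advance : ∀ {j y′} (step : located z (s ∷ ρ) ≡ (s , z) ∷ located y′ ρ) →
        j ≡ length (xs p ++ located y γ) → suc j ≡ length (α (advance step))
      mark-advance {j} step j≡ = begin
        suc j                                        ≡⟨ cong suc (mark-length j≡) ⟩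
        suc (length (α p) ℕ.+ length γ)              ≡⟨ ℕₚ.+-suc (length (α p)) (length γ) ⟨
        length (α p) ℕ.+ suc (length γ)              ≡⟨ cong (length (α p) ℕ.+_) (trans (Listₚ.length-++ γ) (ℕₚ.+-comm (length γ) 1)) ⟨
        length (α p) ℕ.+ length (γ ++ s ∷ [])        ≡⟨ Listₚ.length-++ (α p) ⟨
        length (α p ++ γ ++ s ∷ [])                  ∎

      gap-between : ∀ {i j} → suc i ≡ length (α p) → j ≡ length (xs p ++ located y γ) → between i j π ≡ γ
      gap-between i≡ j≡ = between-++ (α p) γ (s ∷ ρ) i≡ (mark-length j≡) (split p)

    -- The state right behind the marked step U_(k+1) of a path of height `h`; the left gaps already
    -- passed are those at levels 1, ..., k.
    record AfterU (h k : ℕ) : Set where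
      field
        {ρ}    : Path
        pos    : Position (suc k) ρ
        ups    : UpsBelow (suc k) (xs pos)
        dyck   : DyckFrom (suc k) ρ
        top    : peak (suc k) ρ ≡ h
        mark   : suc (posU (suc k) π) ≡ length (α pos)
        filled : water 0 0 π ≡ total leftArea k ℕ.+ water (suc k) (suc k) ρ

    -- The state right behind D_(k+1), where `w` will be the sum over all gaps. The right gaps still
    -- ahead, at levels 1, ..., k, are added to the other side, since subtracting them from `w`
    -- could truncate.
    record AfterD (h w k : ℕ) : Set where
      field
        {ρ}    : Path
        pos    : Position k ρ
        dyck   : DyckFrom k ρ
        top    : peak k ρ ≡ k
        mark   : suc (posD (suc k) π) ≡ length (α pos)
        filled : water 0 0 π ℕ.+ total rightArea k ≡ w ℕ.+ water h k ρ

    after-U₁ : ∀ {h} → DyckFrom 0 π → peak 0 π ≡ suc h → AfterU (suc h) 0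
    after-U₁ {h} (up {π = ρ} d) top = record
      { pos    = position {α = U ∷ []} {(U , 0) ∷ []} refl refl refl
      ; ups    = (λ _ → s≤s z≤n) ∷ []
      ; dyck   = d
      ; top    = top
      ; mark   = refl
      ; filled = refl
      }

    after-U : ∀ {h k} → suc k ℕ.< h → AfterU h k → AfterU h (suc k)
    after-U {h} {k} k<h a
      with γ , ρ′ , refl , b , d , pk , wt ← first-passage (AfterU.dyck a) ℕₚ.≤-refl
        (subst (suc k ℕ.<_) (sym (AfterU.top a)) k<h) = record
      { pos    = advance pos b refl
      ; ups    = Allₚ.++⁺ (All.map (λ lt eq → ℕₚ.m≤n⇒m≤1+n (lt eq)) ups′) ((λ _ → ℕₚ.≤-refl) ∷ [])
      ; dyck   = d
      ; top    = trans pk top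
      ; mark   = mark-advance pos b refl j≡
      ; filled = begin
          water 0 0 π
            ≡⟨ filled ⟩
          total leftArea k ℕ.+ water (suc k) (suc k) ρ
            ≡⟨ cong (total leftArea k ℕ.+_) wt ⟩
          total leftArea k ℕ.+ (depth (suc k) (suc k) γ ℕ.+ water (suc (suc k)) (suc (suc k)) ρ′)
            ≡⟨ cong (λ e → total leftArea k ℕ.+ (e ℕ.+ _)) (trans (cong gapArea (gap-between pos b mark j≡)) (gapArea≡depth b)) ⟨
          total leftArea k ℕ.+ (leftArea k ℕ.+ water (suc (suc k)) (suc (suc k)) ρ′)
            ≡⟨ ℕₚ.+-assoc (total leftArea k) _ _ ⟨
          total leftArea (suc k) ℕ.+ water (suc (suc k)) (suc (suc k)) ρ′ ∎
      }
      where
      open AfterU a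
      ups′ : UpsBelow (suc k) (xs pos ++ located (suc k) γ)
      ups′ = Allₚ.++⁺ ups (Below⇒UpsBelow b)
      j≡ : posU (suc (suc k)) π ≡ length (xs pos ++ located (suc k) γ)
      j≡ = posU-at {π = π} (gap-starts pos b) ups′

    -- W is the water over the rest of π at the position behind step number i.
    record Descent (h k i W : ℕ) : Set where
      field
        {ρ}    : Path
        pos    : Position k ρ
        dyck   : DyckFrom k ρ
        top    : peak k ρ ≡ k
        mark   : suc (posD (suc k) π) ≡ length (α pos)
        filled : W ≡ gapArea (between i (posD (suc k) π) π) ℕ.+ water h k ρ

    descend : ∀ {h k i ρ} → suc k ℕ.≤ h → (p : Position (suc k) ρ) → DyckFrom (suc k) ρ →
      peak (suc k) ρ ≡ suc k → suc i ≡ length (α p) → Descent h k i (water h (suc k) ρ)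
    descend {h} {k} {i} k<h p d top i≡
      with γ , ρ′ , refl , b , d′ , pk , wt ← last-passage d k<h top = record
      { pos    = advance p b refl
      ; dyck   = d′
      ; top    = pk
      ; mark   = mark-advance p b refl j≡
      ; filled = trans wt (cong (ℕ._+ water h k ρ′)
          (sym (trans (cong gapArea (gap-between p b i≡ j≡)) (gapArea≡depth b))))
      }
      where
      j≡ : posD (suc k) π ≡ length (xs p ++ located (suc k) γ)
      j≡ = posD-at {π = π} (gap-starts p b) (All.map
        (λ { s≤k refl → ℕₚ.1+n≰n (ℕₚ.≤-trans s≤k (ℕₚ.≤-reflexive pk)) }) (starts≤peak d′))

    -- The top gap is a descent like the right gaps, except that the marked step in front of it is
    -- the last marked up-step.
    after-D₁ : ∀ {h} → AfterU (suc h) h →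
      AfterD (suc h) (total leftArea h ℕ.+ gapArea (topGap (suc h) π) ℕ.+ total rightArea h) h
    after-D₁ {h} a = record
      { pos    = pos
      ; dyck   = dyck
      ; top    = top
      ; mark   = mark
      ; filled = trans (cong (ℕ._+ total rightArea h) (trans (AfterU.filled a) (cong (total leftArea h ℕ.+_) filled)))
          (rearrange (total leftArea h) (gapArea (topGap (suc h) π)) (water (suc h) h ρ) (total rightArea h))
      }
      where
      open Descent (descend ℕₚ.≤-refl (AfterU.pos a) (AfterU.dyck a) (AfterU.top a) (AfterU.mark a))
      rearrange : ∀ a b c d → a ℕ.+ (b ℕ.+ c) ℕ.+ d ≡ a ℕ.+ b ℕ.+ d ℕ.+ c
      rearrange = solve-∀

    after-D : ∀ {h w k} → suc k ℕ.≤ h → AfterD h w (suc k) → AfterD h w k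
    after-D {h} {w} {k} k<h a = record
      { pos    = pos
      ; dyck   = dyck
      ; top    = top
      ; mark   = mark
      ; filled = ℕₚ.+-cancelʳ-≡ (rightArea k) _ _ (begin
          water 0 0 π ℕ.+ total rightArea k ℕ.+ rightArea k     ≡⟨ ℕₚ.+-assoc (water 0 0 π) _ _ ⟩
          water 0 0 π ℕ.+ total rightArea (suc k)               ≡⟨ AfterD.filled a ⟩
          w ℕ.+ water h (suc k) (AfterD.ρ a)                    ≡⟨ cong (w ℕ.+_) filled ⟩
          w ℕ.+ (rightArea k ℕ.+ water h k ρ)                   ≡⟨ cong (w ℕ.+_) (ℕₚ.+-comm (rightArea k) _) ⟩
          w ℕ.+ (water h k ρ ℕ.+ rightArea k)                   ≡⟨ ℕₚ.+-assoc w _ _ ⟨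
          w ℕ.+ water h k ρ ℕ.+ rightArea k                     ∎)
      }
      where open Descent (descend k<h (AfterD.pos a) (AfterD.dyck a) (AfterD.top a) (AfterD.mark a))

    all-after-U : ∀ {h} → DyckFrom 0 π → peak 0 π ≡ suc h → ∀ k → k ℕ.≤ h → AfterU (suc h) k
    all-after-U d top zero    _   = after-U₁ d top
    all-after-U d top (suc k) k<h = after-U (s≤s k<h) (all-after-U d top k (ℕₚ.<⇒≤ k<h))

    all-after-D : ∀ {h w k} → k ℕ.≤ h → AfterD h w k → AfterD h w 0
    all-after-D {k = zero}  _   a = a
    all-after-D {k = suc k} k<h a = all-after-D (ℕₚ.<⇒≤ k<h) (after-D k<h a)

  waterCapacity≡water : ∀ π → DyckFrom 0 π → waterCapacity π ≡ water 0 0 π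
  waterCapacity≡water π d = trans (cong (λ h → sum (map gapArea (gapsOfHeight h π))) (height≡peak d))
    (lemma (peak 0 π) refl)
    where
    flat : ∀ {ρ M} → DyckFrom 0 ρ → peak 0 ρ ≡ 0 → water M 0 ρ ≡ 0
    flat []     _ = refl
    flat {U ∷ ρ} (up _) peak≡0 = contradiction (ℕₚ.≤-trans (y≤peak 1 ρ) (ℕₚ.≤-reflexive peak≡0)) λ ()
    lemma : ∀ h → peak 0 π ≡ h → sum (map gapArea (gapsOfHeight h π)) ≡ water 0 0 π
    lemma zero    top = sym (flat d top)
    lemma (suc h) top = begin
      gapArea (topGap (suc h) π) ℕ.+ sum (map gapArea (concatMap (λ i → leftGap (suc i) π ∷ rightGap (suc i) π ∷ []) (upTo h)))
        ≡⟨ cong (gapArea (topGap (suc h) π) ℕ.+_)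
             (sum-gaps gapArea (λ i → leftGap (suc i) π) (λ i → rightGap (suc i) π) h) ⟩
      gapArea (topGap (suc h) π) ℕ.+ (total (leftArea π) h ℕ.+ total (rightArea π) h)
        ≡⟨ rearrange (gapArea (topGap (suc h) π)) (total (leftArea π) h) (total (rightArea π) h) ⟩
      total (leftArea π) h ℕ.+ gapArea (topGap (suc h) π) ℕ.+ total (rightArea π) h
        ≡⟨ ℕₚ.+-identityʳ _ ⟨
      total (leftArea π) h ℕ.+ gapArea (topGap (suc h) π) ℕ.+ total (rightArea π) h ℕ.+ 0
        ≡⟨ cong (_ ℕ.+_) (flat dyck top′) ⟨
      total (leftArea π) h ℕ.+ gapArea (topGap (suc h) π) ℕ.+ total (rightArea π) h ℕ.+ water (suc h) 0 ρ
        ≡⟨ filled ⟨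
      water 0 0 π ℕ.+ 0
        ≡⟨ ℕₚ.+-identityʳ _ ⟩
      water 0 0 π ∎
      where
      open AfterD (all-after-D π (ℕₚ.n≤1+n h) (after-D₁ π (all-after-U π d top h ℕₚ.≤-refl))) renaming (top to top′)
      rearrange : ∀ a b c → a ℕ.+ (b ℕ.+ c) ≡ b ℕ.+ a ℕ.+ c
      rearrange = solve-∀

-- Linear equations between generating functions of path ends.

module PathSums {c ℓ₁ ℓ₂} (K : HeytingField c ℓ₁ ℓ₂) (p q : HeytingField.Carrier K) where

  open HeytingField K using (heytingCommutativeRing)
  open DyckSeries K
  open SeriesProperties K
  open WaterCapacity
  open CommutativeRing (HeytingCommutativeRing.commutativeRing heytingCommutativeRing) hiding (rawRing)
  open SemiringExp semiring using (^-homo-*)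
  open Solver commutativeSemiring using (solve; _:=_; _:+_; _:*_)

  private module 𝕊 = CommutativeRing seriesRing

  -- Sums run over all words of a given length, with the condition on the path moved into the
  -- summand. Splitting by the first step is then plain linearity.
  indicator : ∀ {a} {A : Set a} → Dec A → Carrier → Carrier
  indicator (yes _) x = x
  indicator (no _)  x = 0#

  module _ {a} {A : Set a} where

    indicator-no : ∀ (A? : Dec A) {x} → ¬ A → indicator A? x ≈ 0#
    indicator-no (yes a) ¬a = contradiction a ¬a
    indicator-no (no _)  ¬a = refl

    indicator-yes : ∀ (A? : Dec A) {x} → A → indicator A? x ≈ x
    indicator-yes (yes _) a = refl
    indicator-yes (no ¬a) a = contradiction a ¬a

    indicator-scale : ∀ {b} {B : Set b} (A? : Dec A) (B? : Dec B) {x y z} → (A → B) → (B → A) →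
      (A → x ≈ y * z) → indicator A? x ≈ y * indicator B? z
    indicator-scale (yes a) (yes b) f g eq = eq a
    indicator-scale (yes a) (no ¬b) f g eq = contradiction (f a) ¬b
    indicator-scale (no ¬a) (yes b) f g eq = contradiction (g b) ¬a
    indicator-scale (no ¬a) (no ¬b) f g eq = sym (zeroʳ _)

    indicator-split : ∀ {b c} {B : Set b} {C : Set c} (A? : Dec A) (B? : Dec B) (C? : Dec C) {x y z} →
      (A → B ⊎ C) → (B → A) → (C → A) → (B → ¬ C) →
      (A → x ≈ y * z) → indicator A? x ≈ y * (indicator B? z + indicator C? z)
    indicator-split (yes a) (yes b) (yes c) f g h excl eq = contradiction c (excl b)
    indicator-split (yes a) (yes b) (no ¬c) f g h excl eq = trans (eq a) (*-congˡ (sym (+-identityʳ _)))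
    indicator-split (yes a) (no ¬b) (yes c) f g h excl eq = trans (eq a) (*-congˡ (sym (+-identityˡ _)))
    indicator-split (yes a) (no ¬b) (no ¬c) f g h excl eq with f a
    ... | inj₁ b = contradiction b ¬b
    ... | inj₂ c = contradiction c ¬c
    indicator-split (no ¬a) (yes b) C?      f g h excl eq = contradiction (g b) ¬a
    indicator-split (no ¬a) (no _)  (yes c) f g h excl eq = contradiction (h c) ¬a
    indicator-split (no ¬a) (no _)  (no _)  f g h excl eq =
      sym (trans (*-congˡ (+-identityˡ 0#)) (zeroʳ _))

  ∑ : ∀ {A : Set} → (A → Carrier) → List A → Carrier
  ∑ f xs = foldr _+_ 0# (map f xs)

  ∑-map-++ : ∀ {A B : Set} (f : B → Carrier) (g h : A → B) xs ys →
    ∑ f (map g xs ++ map h ys) ≈ ∑ (f ∘ g) xs + ∑ (f ∘ h) ys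
  ∑-map-++ f g h [] [] = sym (+-identityˡ 0#)
  ∑-map-++ f g h [] (y ∷ ys) =
    trans (+-congˡ (trans (∑-map-++ f g h [] ys) (+-identityˡ _))) (sym (+-identityˡ _))
  ∑-map-++ f g h (x ∷ xs) ys = trans (+-congˡ (∑-map-++ f g h xs ys)) (sym (+-assoc _ _ _))

  ∑-+ : ∀ {A : Set} (f g : A → Carrier) xs → ∑ (λ x → f x + g x) xs ≈ ∑ f xs + ∑ g xs
  ∑-+ f g []       = sym (+-identityˡ 0#)
  ∑-+ f g (x ∷ xs) = trans (+-congˡ (∑-+ f g xs))
    (solve 4 (λ a b c d → a :+ b :+ (c :+ d) := a :+ c :+ (b :+ d)) refl _ _ _ _)

  ∑-* : ∀ {A : Set} a (f : A → Carrier) xs → ∑ (λ x → a * f x) xs ≈ a * ∑ f xs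
  ∑-* a f []       = sym (zeroʳ a)
  ∑-* a f (x ∷ xs) = trans (+-congˡ (∑-* a f xs)) (sym (distribˡ a _ _))

  ∑-cong : ∀ {A : Set} {f g : A → Carrier} xs → (∀ x → f x ≈ g x) → ∑ f xs ≈ ∑ g xs
  ∑-cong []       eq = refl
  ∑-cong (x ∷ xs) eq = +-cong (eq x) (∑-cong xs eq)

  ∑-zero : ∀ {A : Set} {f : A → Carrier} xs → (∀ x → f x ≈ 0#) → ∑ f xs ≈ 0#
  ∑-zero []       eq = refl
  ∑-zero (x ∷ xs) eq = trans (+-cong (eq x) (∑-zero xs eq)) (+-identityˡ 0#)

  ∑-words-suc : ∀ (f : Path → Carrier) n →
    ∑ f (words (suc n)) ≈ ∑ (f ∘ (U ∷_)) (words n) + ∑ (f ∘ (D ∷_)) (words n)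
  ∑-words-suc f n = ∑-map-++ f (U ∷_) (D ∷_) (words n) (words n)

  ∑-words-zero : ∀ (f : Path → Carrier) n → (∀ π → length π ≡ n → f π ≈ 0#) → ∑ f (words n) ≈ 0#
  ∑-words-zero f zero    eq = trans (+-identityʳ _) (eq [] ≡.refl)
  ∑-words-zero f (suc n) eq = trans (∑-words-suc f n) (trans (+-cong
    (∑-words-zero (f ∘ (U ∷_)) n λ π len → eq (U ∷ π) (≡.cong suc len))
    (∑-words-zero (f ∘ (D ∷_)) n λ π len → eq (D ∷ π) (≡.cong suc len))) (+-identityˡ 0#))

  DyckPeak : ℕ → ℕ → Path → Set
  DyckPeak k y π = DyckFrom y π × peak y π ≡ k

  dyckPeak? : ∀ k y π → Dec (DyckPeak k y π)
  dyckPeak? k y π = dyckFrom? y π ×-dec (peak y π ℕₚ.≟ k)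

  weight : ℕ → ℕ → Path → Carrier
  weight M y π = p ^ water M y π * q ^ area y π

  term : ℕ → ℕ → ℕ → Path → Carrier
  term M k y π = indicator (dyckPeak? k y π) (weight M y π)

  stepWeight : ℕ → ℕ → Carrier
  stepWeight μ y = p ^ (μ ∸ y) * q ^ y

  weight-step : ∀ {e μ} y w a → e ≡ μ → p ^ ((e ∸ y) ℕ.+ w) * q ^ (y ℕ.+ a) ≈ stepWeight μ y * (p ^ w * q ^ a)
  weight-step {e} y w a ≡.refl = trans
    (*-cong (^-homo-* p (e ∸ y) w) (^-homo-* q y a))
    (solve 4 (λ a b c d → a :* b :* (c :* d) := a :* c :* (b :* d)) refl _ _ _ _)

  term-up : ∀ M k y π → term M k y (U ∷ π) ≈ stepWeight (M ⊓ k) y * term (M ⊔ suc y) k (suc y) π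
  term-up M k y π = indicator-scale (dyckPeak? k y (U ∷ π)) (dyckPeak? k (suc y) π)
    (λ { (up d , pk) → d , pk }) (λ { (d , pk) → up d , pk })
    (λ { (_ , pk) → weight-step y (water (M ⊔ suc y) (suc y) π) (area (suc y) π) (≡.cong (M ⊓_) pk) })

  term-down : ∀ M k y π → suc y ℕ.< k →
    term M k (suc y) (D ∷ π) ≈ stepWeight (M ⊓ k) (suc y) * term M k y π
  term-down M k y π y<k = indicator-scale (dyckPeak? k (suc y) (D ∷ π)) (dyckPeak? k y π)
    (λ { (down d , pk) → d , peak⁻ pk })
    (λ { (d , pk) → down d , ≡.trans (≡.cong (suc y ⊔_) pk) (ℕₚ.m≤n⇒m⊔n≡n (ℕₚ.<⇒≤ y<k)) })
    (λ { (_ , pk) → weight-step (suc y) (water M y π) (area y π) (≡.cong (M ⊓_) pk) })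
    where
    peak⁻ : suc y ⊔ peak y π ≡ k → peak y π ≡ k
    peak⁻ pk with ℕₚ.⊔-sel (suc y) (peak y π)
    ... | inj₁ eq = contradiction (≡.trans (≡.sym eq) pk) (ℕₚ.<⇒≢ y<k)
    ... | inj₂ eq = ≡.trans (≡.sym eq) pk

  term-zero : ∀ M k y π → ¬ DyckPeak k y π → term M k y π ≈ 0#
  term-zero M k y π = indicator-no (dyckPeak? k y π)

  -- After leaving the level of its peak, a path has a peak at the same level
  -- or one level below.
  term-down-top : ∀ M j π →
    term M (suc j) (suc j) (D ∷ π) ≈
      stepWeight (M ⊓ suc j) (suc j) * (term M (suc j) j π + term M j j π)
  term-down-top M j π = indicator-split
    (dyckPeak? (suc j) (suc j) (D ∷ π)) (dyckPeak? (suc j) j π) (dyckPeak? j j π)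
    (λ { (down d , pk) → split d pk })
    (λ { (d , pk) → down d , ≡.trans (≡.cong (suc j ⊔_) pk) (ℕₚ.⊔-idem (suc j)) })
    (λ { (d , pk) → down d , ≡.trans (≡.cong (suc j ⊔_) pk) (ℕₚ.m≥n⇒m⊔n≡m (ℕₚ.n≤1+n j)) })
    (λ { (_ , pk) (_ , pk′) → ℕₚ.1+n≢n (≡.trans (≡.sym pk) pk′) })
    (λ { (_ , pk) → weight-step (suc j) (water M j π) (area j π) (≡.cong (M ⊓_) pk) })
    where
    split : DyckFrom j π → suc j ⊔ peak j π ≡ suc j → DyckPeak (suc j) j π ⊎ DyckPeak j j π
    split d pk with ℕₚ.m≤n⇒m<n∨m≡n (ℕₚ.m⊔n≡m⇒n≤m pk)
    ... | inj₁ (s≤s peak≤j) = inj₂ (d , ℕₚ.≤-antisym peak≤j (y≤peak j π))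
    ... | inj₂ eq           = inj₁ (d , eq)

  pathSum : ℕ → ℕ → ℕ → ℕ → Carrier
  pathSum M k y n = ∑ (term M k y) (words n)

  pathSum-short : ∀ M k y n → n ℕ.< y → pathSum M k y n ≈ 0#
  pathSum-short M k y n n<y = ∑-words-zero (term M k y) n λ π len →
    term-zero M k y π λ { (d , _) → ℕₚ.<⇒≱ n<y (ℕₚ.≤-trans (y≤length d) (ℕₚ.≤-reflexive len)) }
    where
    y≤length : ∀ {y π} → DyckFrom y π → y ℕ.≤ length π
    y≤length []       = z≤n
    y≤length (up d)   = ℕₚ.≤-trans (ℕₚ.n≤1+n _) (ℕₚ.m≤n⇒m≤1+n (y≤length d))
    y≤length (down d) = s≤s (y≤length d)

  pathSum-high : ∀ M k y n → k ℕ.< y → pathSum M k y n ≈ 0#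
  pathSum-high M k y n k<y = ∑-zero (words n) λ π →
    term-zero M k y π λ { (_ , pk) → ℕₚ.<⇒≱ k<y (ℕₚ.≤-trans (y≤peak y π) (ℕₚ.≤-reflexive pk)) }

  pathSum-bottom : ∀ M k n →
    pathSum M k 0 (suc n) ≈ stepWeight (M ⊓ k) 0 * pathSum (M ⊔ 1) k 1 n
  pathSum-bottom M k n = trans (∑-words-suc (term M k 0) n) (trans (+-cong
    (trans (∑-cong (words n) (term-up M k 0)) (∑-* _ (term (M ⊔ 1) k 1) (words n)))
    (∑-zero (words n) λ π → term-zero M k 0 (D ∷ π) λ ())) (+-identityʳ _))

  pathSum-interior : ∀ M k y n → suc y ℕ.< k →
    pathSum M k (suc y) (suc n) ≈
      stepWeight (M ⊓ k) (suc y) * (pathSum (M ⊔ suc (suc y)) k (suc (suc y)) n + pathSum M k y n)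
  pathSum-interior M k y n y<k = trans (∑-words-suc (term M k (suc y)) n) (trans (+-cong
    (trans (∑-cong (words n) (term-up M k (suc y))) (∑-* _ (term _ k (suc (suc y))) (words n)))
    (trans (∑-cong (words n) λ π → term-down M k y π y<k) (∑-* _ (term M k y) (words n))))
    (sym (distribˡ _ _ _)))

  pathSum-top : ∀ M j n →
    pathSum M (suc j) (suc j) (suc n) ≈
      stepWeight (M ⊓ suc j) (suc j) * (pathSum M (suc j) j n + pathSum M j j n)
  pathSum-top M j n = trans (∑-words-suc (term M (suc j) (suc j)) n) (trans (+-cong
    (trans (∑-cong (words n) (term-up M (suc j) (suc j)))
      (trans (∑-* _ (term _ (suc j) (suc (suc j))) (words n))
        (trans (*-congˡ (pathSum-high _ (suc j) (suc (suc j)) n ℕₚ.≤-refl)) (zeroʳ _))))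
    (trans (∑-cong (words n) (term-down-top M j))
      (trans (∑-* _ _ (words n)) (*-congˡ (∑-+ (term M (suc j) j) (term M j j) (words n))))))
    (+-identityˡ _))

  -- The exponent of x counts up-steps: a Dyck path from height y with n
  -- up-steps has 2n + y steps.
  pathSeries : ℕ → ℕ → ℕ → Series
  pathSeries M k y n = pathSum M k y (2 ℕ.* n ℕ.+ y)

  length-shift : ∀ n y → 2 ℕ.* suc n ℕ.+ y ≡ 2 ℕ.* n ℕ.+ suc (suc y)
  length-shift = solve-∀

  pathSeries-0 : ∀ M → pathSeries M 0 0 ≈ˢ 1ˢ
  pathSeries-0 M zero    = trans (+-identityʳ _) (*-identityˡ 1#)
  pathSeries-0 M (suc n) = trans (pathSum-bottom M 0 (n ℕ.+ suc (n ℕ.+ 0) ℕ.+ 0))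
    (trans (*-congˡ (pathSum-high (M ⊔ 1) 0 1 (n ℕ.+ suc (n ℕ.+ 0) ℕ.+ 0) (s≤s z≤n))) (zeroʳ _))

  ascent descent : ℕ → ℕ → Series
  ascent  μ y = const (stepWeight μ y) *ˢ 𝕩
  descent μ y = const (stepWeight μ y)

  ascent-zero : ∀ μ y f → (ascent μ y *ˢ f) 0 ≈ 0#
  ascent-zero μ y f = trans (*ˢ-head (ascent μ y) f)
    (trans (*-congʳ (trans (*ˢ-head (descent μ y) 𝕩) (zeroʳ _))) (zeroˡ _))

  ascent-suc : ∀ μ y f n → (ascent μ y *ˢ f) (suc n) ≈ stepWeight μ y * f n
  ascent-suc μ y f n = trans (*ˢ-assoc (descent μ y) 𝕩 f (suc n))
    (trans (const-*ˢ _ (𝕩 *ˢ f) (suc n)) (*-congˡ (𝕩*ˢ-suc f n)))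

  pathSeries-bottom : ∀ M k → 0 ℕ.< k →
    pathSeries M k 0 ≈ˢ ascent (M ⊓ k) 0 *ˢ pathSeries (M ⊔ 1) k 1
  pathSeries-bottom M (suc k) _ zero    =
    trans (+-identityʳ _) (sym (ascent-zero (M ⊓ suc k) 0 (pathSeries (M ⊔ 1) (suc k) 1)))
  pathSeries-bottom M (suc k) _ (suc n) = begin
    pathSum M (suc k) 0 (suc (n ℕ.+ suc (n ℕ.+ 0) ℕ.+ 0))
      ≈⟨ pathSum-bottom M (suc k) (n ℕ.+ suc (n ℕ.+ 0) ℕ.+ 0) ⟩
    stepWeight (M ⊓ suc k) 0 * pathSum (M ⊔ 1) (suc k) 1 (n ℕ.+ suc (n ℕ.+ 0) ℕ.+ 0)
      ≡⟨ ≡.cong (λ m → stepWeight (M ⊓ suc k) 0 * pathSum (M ⊔ 1) (suc k) 1 m) (ℕₚ.suc-injective (length-shift′ n)) ⟩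
    stepWeight (M ⊓ suc k) 0 * pathSum (M ⊔ 1) (suc k) 1 (2 ℕ.* n ℕ.+ 1)
      ≈⟨ ascent-suc (M ⊓ suc k) 0 (pathSeries (M ⊔ 1) (suc k) 1) n ⟨
    (ascent (M ⊓ suc k) 0 *ˢ pathSeries (M ⊔ 1) (suc k) 1) (suc n) ∎
    where
    open ≈-Reasoning setoid
    length-shift′ : ∀ n → 2 ℕ.* suc n ℕ.+ 0 ≡ suc (2 ℕ.* n ℕ.+ 1)
    length-shift′ = solve-∀

  length-suc : ∀ n y → 2 ℕ.* n ℕ.+ suc y ≡ suc (2 ℕ.* n ℕ.+ y)
  length-suc = λ n y → ℕₚ.+-suc (2 ℕ.* n) y

  pathSeries-interior : ∀ M k y → suc y ℕ.< k →
    pathSeries M k (suc y) ≈ˢ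
      (ascent (M ⊓ k) (suc y) *ˢ pathSeries (M ⊔ suc (suc y)) k (suc (suc y)))
        +ˢ (descent (M ⊓ k) (suc y) *ˢ pathSeries M k y)
  pathSeries-interior M k y y<k n = begin
    pathSum M k (suc y) (2 ℕ.* n ℕ.+ suc y)
      ≡⟨ ≡.cong (pathSum M k (suc y)) (length-suc n y) ⟩
    pathSum M k (suc y) (suc (2 ℕ.* n ℕ.+ y))
      ≈⟨ pathSum-interior M k y (2 ℕ.* n ℕ.+ y) y<k ⟩
    a * (pathSum M′ k (suc (suc y)) (2 ℕ.* n ℕ.+ y) + pathSeries M k y n)
      ≈⟨ distribˡ a _ _ ⟩
    a * pathSum M′ k (suc (suc y)) (2 ℕ.* n ℕ.+ y) + a * pathSeries M k y n
      ≈⟨ +-cong (ascending n) (sym (const-*ˢ a (pathSeries M k y) n)) ⟩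
    (ascent (M ⊓ k) (suc y) *ˢ pathSeries M′ k (suc (suc y))) n
      + (descent (M ⊓ k) (suc y) *ˢ pathSeries M k y) n ∎
    where
    open ≈-Reasoning setoid
    a = stepWeight (M ⊓ k) (suc y)
    M′ = M ⊔ suc (suc y)
    ascending : ∀ n → a * pathSum M′ k (suc (suc y)) (2 ℕ.* n ℕ.+ y)
      ≈ (ascent (M ⊓ k) (suc y) *ˢ pathSeries M′ k (suc (suc y))) n
    -- At x^0 no up-step is left: the remaining `y` steps cannot descend from height y + 2.
    ascending zero    = trans (*-congˡ (pathSum-short M′ k (suc (suc y)) y (ℕₚ.m≤n⇒m≤1+n ℕₚ.≤-refl)))
      (trans (zeroʳ a) (sym (ascent-zero (M ⊓ k) (suc y) (pathSeries M′ k (suc (suc y))))))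
    ascending (suc n) =
      trans (*-congˡ (reflexive (≡.cong (pathSum M′ k (suc (suc y))) (length-shift n y))))
        (sym (ascent-suc (M ⊓ k) (suc y) (pathSeries M′ k (suc (suc y))) n))

  pathSeries-top : ∀ M j →
    pathSeries M (suc j) (suc j) ≈ˢ
      (descent (M ⊓ suc j) (suc j) *ˢ pathSeries M j j)
        +ˢ (descent (M ⊓ suc j) (suc j) *ˢ pathSeries M (suc j) j)
  pathSeries-top M j n = begin
    pathSum M (suc j) (suc j) (2 ℕ.* n ℕ.+ suc j)
      ≡⟨ ≡.cong (pathSum M (suc j) (suc j)) (length-suc n j) ⟩
    pathSum M (suc j) (suc j) (suc (2 ℕ.* n ℕ.+ j))
      ≈⟨ pathSum-top M j (2 ℕ.* n ℕ.+ j) ⟩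
    a * (pathSeries M (suc j) j n + pathSeries M j j n)
      ≈⟨ trans (distribˡ a _ _) (+-comm _ _) ⟩
    a * pathSeries M j j n + a * pathSeries M (suc j) j n
      ≈⟨ +-cong (const-*ˢ a (pathSeries M j j) n) (const-*ˢ a (pathSeries M (suc j) j) n) ⟨
    (descent (M ⊓ suc j) (suc j) *ˢ pathSeries M j j) n
      + (descent (M ⊓ suc j) (suc j) *ˢ pathSeries M (suc j) j) n ∎
    where
    open ≈-Reasoning setoid
    a = stepWeight (M ⊓ suc j) (suc j)

  -- For M = k = μ this describes the top gap, for M < k the left gap at level
  -- μ = M, and for k < M the right gap at level μ = k.
  module Level (M k : ℕ) where

    μ : ℕ
    μ = M ⊓ k

    open Tridiagonal (ascent μ) (descent μ) (pathSeries M k) public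

    -- Ascents to a level not above `M` leave the running maximum unchanged, so the unknowns with
    -- fixed `M` and `k` form a closed system.
    raise : ∀ {y} → y ℕ.≤ M → ∀ f → f *ˢ pathSeries (M ⊔ y) k y ≈ˢ f *ˢ pathSeries M k y
    raise {y} y≤M f n = reflexive (≡.cong (λ m → (f *ˢ pathSeries m k y) n) (ℕₚ.m≥n⇒m⊔n≡m y≤M))

    below : ∀ n → suc n ℕ.≤ μ →
      pathSeries M k n *ˢ minor (suc n) ≈ˢ minor n *ˢ (ascent μ n *ˢ pathSeries M k (suc n))
    below n n<μ = eliminate-below n
      (𝕊.trans {pathSeries M k 0} (pathSeries-bottom M k (ℕₚ.≤-trans (s≤s z≤n) (bound-k n<μ)))
        (raise (ℕₚ.≤-trans (s≤s z≤n) (bound-M n<μ)) (ascent μ 0)))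
      (λ y y<n → 𝕊.trans {pathSeries M k (suc y)}
        (pathSeries-interior M k y (bound-k (ℕₚ.≤-trans (s≤s y<n) n<μ)))
        (𝕊.+-congʳ {descent μ (suc y) *ˢ pathSeries M k y}
          (raise (bound-M (ℕₚ.≤-trans (s≤s y<n) n<μ)) (ascent μ (suc y)))))
      where
      bound-M : ∀ {m} → m ℕ.≤ μ → m ℕ.≤ M
      bound-M m≤μ = ℕₚ.≤-trans m≤μ (ℕₚ.m⊓n≤m M k)
      bound-k : ∀ {m} → m ℕ.≤ μ → m ℕ.≤ k
      bound-k m≤μ = ℕₚ.≤-trans m≤μ (ℕₚ.m⊓n≤n M k)

  open Level using (minor)

  -- The gap is left by the ascent to `suc M`, the only step that changes the running maximum; its
  -- term is the `T` of the elimination. For `M = 0` this is the empty gap in front of the first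
  -- step.
  left-gap : ∀ M k → M ℕ.< k →
    pathSeries M k M *ˢ minor M k (suc M) ≈ˢ
      minor M k M *ˢ (ascent (M ⊓ k) M *ˢ pathSeries (suc M) k (suc M))
  left-gap zero k 0<k = Level.eliminate-bottom 0 k _ (pathSeries-bottom 0 k 0<k)
  left-gap (suc M) k M<k = Level.eliminate-top (suc M) k M _
    (Level.below (suc M) k M (≡.subst (suc M ℕ.≤_) (≡.sym (ℕₚ.m≤n⇒m⊓n≡m (ℕₚ.<⇒≤ M<k))) ℕₚ.≤-refl))
    (λ n → trans (pathSeries-interior (suc M) k M M<k n)
      (+-congʳ (reflexive (≡.cong (λ m → (ascent (suc M ⊓ k) (suc M) *ˢ pathSeries m k (suc (suc M))) n)
        (ℕₚ.m≤n⇒m⊔n≡n (ℕₚ.n≤1+n (suc M)))))))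

  -- The term leaving the system is the descent after which the future maximum drops to `k`. With
  -- `M` equal to `suc k` this is the top gap.
  right-gap : ∀ M k → suc k ℕ.≤ M →
    pathSeries M (suc k) (suc k) *ˢ minor M (suc k) (suc (suc k)) ≈ˢ
      minor M (suc k) (suc k) *ˢ (descent (M ⊓ suc k) (suc k) *ˢ pathSeries M k k)
  right-gap M k k<M = Level.eliminate-top M (suc k) k _
    (Level.below M (suc k) k (≡.subst (suc k ℕ.≤_) (≡.sym (ℕₚ.m≥n⇒m⊓n≡n k<M)) ℕₚ.≤-refl))
    (pathSeries-top M k)

-- Finite products and telescoping.

module FiniteProducts {a ℓ} (A : CommutativeRing a ℓ) where

  open CommutativeRing A
  open RawSemiringDefinitions (RawRing.rawSemiring rawRing) using (_^_; product)
  open Solver commutativeSemiring using (solve; _:=_; _:*_)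
  open ≈-Reasoning setoid

  -- The new factor comes last, as in the telescoping arguments; `product` over `Fin` puts it first.
  ∏ : (ℕ → Carrier) → ℕ → Carrier
  ∏ F zero    = 1#
  ∏ F (suc n) = ∏ F n * F n

  ∏-cong : ∀ {F G} n → (∀ i → F i ≈ G i) → ∏ F n ≈ ∏ G n
  ∏-cong zero    F≈G = refl
  ∏-cong (suc n) F≈G = *-cong (∏-cong n F≈G) (F≈G n)

  ∏-front : ∀ F n → ∏ F (suc n) ≈ F 0 * ∏ (F ∘ suc) n
  ∏-front F zero    = trans (*-identityˡ _) (sym (*-identityʳ _))
  ∏-front F (suc n) = trans (*-congʳ (∏-front F n)) (*-assoc _ _ _)

  ∏-tail : ∀ F n → F 0 ≈ 1# → ∏ (F ∘ suc) n ≈ ∏ F n * F n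
  ∏-tail F n F₀≈1 = sym (trans (∏-front F n) (trans (*-congʳ F₀≈1) (*-identityˡ _)))

  product-^2≈∏ : ∀ F n → product {n} (λ i → F (toℕ i) ^ 2) ≈ ∏ F n * ∏ F n
  product-^2≈∏ F zero    = sym (*-identityˡ 1#)
  product-^2≈∏ F (suc n) = begin
    F 0 ^ 2 * product {n} (λ i → F (suc (toℕ i)) ^ 2)
      ≈⟨ *-cong (*-congˡ (*-identityʳ _)) (product-^2≈∏ (F ∘ suc) n) ⟩
    F 0 * F 0 * (∏ (F ∘ suc) n * ∏ (F ∘ suc) n)
      ≈⟨ solve 2 (λ x y → x :* x :* (y :* y) := (x :* y) :* (x :* y)) refl _ _ ⟩
    F 0 * ∏ (F ∘ suc) n * (F 0 * ∏ (F ∘ suc) n)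
      ≈⟨ *-cong (∏-front F n) (∏-front F n) ⟨
    ∏ F (suc n) * ∏ F (suc n) ∎

  telescope-up : ∀ (S b c : ℕ → Carrier) h → (∀ k → k ℕ.< h → S k * b k ≈ c k * S (suc k)) →
    ∀ k → k ℕ.≤ h → S 0 * ∏ b k ≈ ∏ c k * S k
  telescope-up   S b c h rec zero    _   = *-comm _ _
  telescope-up   S b c h rec (suc k) k<h = begin
    S 0 * (∏ b k * b k)       ≈⟨ *-assoc _ _ _ ⟨
    S 0 * ∏ b k * b k         ≈⟨ *-congʳ (telescope-up S b c h rec k (ℕₚ.<⇒≤ k<h)) ⟩
    ∏ c k * S k * b k         ≈⟨ *-assoc _ _ _ ⟩
    ∏ c k * (S k * b k)       ≈⟨ *-congˡ (rec k k<h) ⟩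
    ∏ c k * (c k * S (suc k)) ≈⟨ *-assoc _ _ _ ⟨
    ∏ c k * c k * S (suc k)   ∎

  telescope-down : ∀ (S b c : ℕ → Carrier) h → S 0 ≈ 1# → (∀ k → k ℕ.< h → S (suc k) * b k ≈ c k * S k) →
    ∀ k → k ℕ.≤ h → S k * ∏ b k ≈ ∏ c k
  telescope-down S b c h S₀≈1 rec zero    _   = trans (*-identityʳ _) S₀≈1
  telescope-down S b c h S₀≈1 rec (suc k) k<h = begin
    S (suc k) * (∏ b k * b k)   ≈⟨ solve 3 (λ s b′ b → s :* (b′ :* b) := s :* b :* b′) refl _ _ _ ⟩
    S (suc k) * b k * ∏ b k     ≈⟨ *-congʳ (rec k k<h) ⟩
    c k * S k * ∏ b k           ≈⟨ *-assoc _ _ _ ⟩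
    c k * (S k * ∏ b k)         ≈⟨ *-congˡ (telescope-down S b c h S₀≈1 rec k (ℕₚ.<⇒≤ k<h)) ⟩
    c k * ∏ c k                 ≈⟨ *-comm _ _ ⟩
    ∏ c k * c k                 ∎

  -- In the application `n h` is q^(h²) and `w h` is q^h, so the recurrence reads (h+1)² = h² + h +
  -- (h+1): the marked up-step from h and the marked down-step from h + 1 are added.
  ∏-numerators : ∀ {x} {n : ℕ → Carrier} (b w : ℕ → Carrier) → n 0 ≈ 1# →
    (∀ h → n (suc h) ≈ n h * (w h * w (suc h))) → ∀ h →
    ∏ (λ k → b k * (w k * x)) h * ∏ (λ k → b (suc k) * w (suc k)) h
      ≈ x ^ h * n h * (∏ b h * ∏ (b ∘ suc) h)
  ∏-numerators b w n₀≈1 rec zero = trans (*-cong (sym (trans (*-identityˡ _) n₀≈1)) (sym (*-identityˡ 1#))) refl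
  ∏-numerators {x} {n} b w n₀≈1 rec (suc h) = begin
    ∏ F h * (b h * (w h * x)) * (∏ G h * (b (suc h) * w (suc h)))
      ≈⟨ solve 7 (λ f b₀ w₀ x g b₁ w₁ → f :* (b₀ :* (w₀ :* x)) :* (g :* (b₁ :* w₁))
           := f :* g :* (x :* (w₀ :* w₁) :* (b₀ :* b₁))) refl (∏ F h) (b h) (w h) x (∏ G h) (b (suc h)) (w (suc h)) ⟩
    ∏ F h * ∏ G h * (x * (w h * w (suc h)) * (b h * b (suc h)))
      ≈⟨ *-congʳ (∏-numerators b w n₀≈1 rec h) ⟩
    x ^ h * n h * (∏ b h * ∏ (b ∘ suc) h) * (x * (w h * w (suc h)) * (b h * b (suc h)))
      ≈⟨ solve 8 (λ y n f g x w b₀ b₁ → y :* n :* (f :* g) :* (x :* w :* (b₀ :* b₁))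
           := x :* y :* (n :* w) :* (f :* b₀ :* (g :* b₁))) refl (x ^ h) (n h) (∏ b h) (∏ (b ∘ suc) h) x (w h * w (suc h)) (b h) (b (suc h)) ⟩
    x * x ^ h * (n h * (w h * w (suc h))) * (∏ b h * b h * (∏ (b ∘ suc) h * b (suc h)))
      ≈⟨ *-congʳ (*-congˡ (rec h)) ⟨
    x ^ suc h * n (suc h) * (∏ b (suc h) * ∏ (b ∘ suc) (suc h)) ∎
    where
    F G : ℕ → Carrier
    F k = b k * (w k * x)
    G k = b (suc k) * w (suc k)

-- The factors of R and their symmetry.

module Factors {c ℓ₁ ℓ₂} (K : HeytingField c ℓ₁ ℓ₂) where

  open HeytingField K using (heytingCommutativeRing; #⇒invertible)
  open DyckSeries K
  open SeriesProperties K
  open CommutativeRing (HeytingCommutativeRing.commutativeRing heytingCommutativeRing) hiding (rawRing)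
  open RingProperties ring using (-0#≈0#)
  open SemiringExp semiring using (^-homo-*)
  open Solver commutativeSemiring using (solve; _:=_; _:*_)
  open FiniteProducts seriesRing

  private module 𝕊 = CommutativeRing seriesRing

  ⁻¹-inverse : ∀ (a : Nonzero) → proj₁ a * a ⁻¹ ≈ 1#
  ⁻¹-inverse (a , a#0) with b , _ , inverse ← #⇒invertible a#0 =
    trans (*-congʳ (sym (trans (+-congˡ -0#≈0#) (+-identityʳ a)))) inverse

  β : ℕ → Series → Nonzero → Nonzero → Series
  β k x p q = evalP k (ℤ.+ (2 ℕ.* k) ℤ.- ℤ.+ 3) x p q

  β-0 : ∀ x p q → β 0 x p q ≈ˢ 1ˢ
  β-0 x p q = P-0 1ˢ 1ˢ

  evalP-exponent : ∀ h x p q → evalP (suc h) (ℤ.+ (2 ℕ.* h) ℤ.- ℤ.+ 1) x p q ≈ˢ β (suc h) x p q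
  evalP-exponent h x p q n = reflexive (≡.cong (λ e → evalP (suc h) e x p q n) (≡.sym (≡.trans
    (≡.cong (ℤ._⊖ 3) (double h))
    (≡.trans (ℤₚ.[1+m]⊖[1+n]≡m⊖n (suc (2 ℕ.* h)) 2) (ℤₚ.[1+m]⊖[1+n]≡m⊖n (2 ℕ.* h) 1)))))
    where
    double : ∀ h → 2 ℕ.* suc h ≡ suc (suc (2 ℕ.* h))
    double = solve-∀

  -- The unsquared last factor of R has the same form as the others. Since b_0 = 1, the formula also
  -- yields R_(-1) = 1, so the empty path needs no separate treatment later.
  R-pred≈∏ : ∀ h x p q → let b = λ k → β k x p q in R-pred h x p q ≈ˢ ∏ b h *ˢ ∏ b h *ˢ b h
  R-pred≈∏ zero    x p q =
    𝕊.sym {1ˢ *ˢ 1ˢ *ˢ β 0 x p q} (𝕊.trans {j = 1ˢ *ˢ 1ˢ *ˢ 1ˢ} (*ˢ-congˡ (1ˢ *ˢ 1ˢ) (β-0 x p q))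
      (𝕊.trans {j = 1ˢ *ˢ 1ˢ} (𝕊.*-identityʳ (1ˢ *ˢ 1ˢ)) (𝕊.*-identityʳ 1ˢ)))
  R-pred≈∏ (suc h) x p q =
    *ˢ-cong (product-^2≈∏ (λ k → β k x p q) (suc h)) (evalP-exponent h x p q)

  -- From k = 2 on, where P_k depends on its arguments, the exponent 2k - 3 is a natural number. It
  -- is split as n + (n+1) because the two steps of a pair start at consecutive heights.
  power-exponent : ∀ (q : Nonzero) n →
    q ^ℤ (ℤ.+ (2 ℕ.* suc (suc n)) ℤ.- ℤ.+ 3) ≈ proj₁ q ^ n * proj₁ q ^ suc n
  power-exponent q n = trans (reflexive (≡.cong (q ^ℤ_) exponent)) (^-homo-* (proj₁ q) n (suc n))
    where
    double : ∀ n → 2 ℕ.* suc (suc n) ≡ 3 ℕ.+ (n ℕ.+ suc n)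
    double = solve-∀
    exponent : ℤ.+ (2 ℕ.* suc (suc n)) ℤ.- ℤ.+ 3 ≡ ℤ.+ (n ℕ.+ suc n)
    exponent = ≡.trans (≡.cong (ℤ._⊖ 3) (double n)) (ℤₚ.⊖-≥ {3 ℕ.+ (n ℕ.+ suc n)} {3} (s≤s (s≤s (s≤s z≤n))))

  base : Nonzero → Nonzero → Carrier
  base p q = proj₁ p ^ 2 * (q ⁻¹) ^ 2

  base-*-square : ∀ p q → base p q * (proj₁ q * proj₁ q) ≈ proj₁ p * proj₁ p
  base-*-square p q = begin
    a * (a * 1#) * (i * (i * 1#)) * (b * b)  ≈⟨ *-congʳ (*-cong (*-congˡ (*-identityʳ a)) (*-congˡ (*-identityʳ i))) ⟩
    a * a * (i * i) * (b * b)                ≈⟨ solve 3 (λ a i b → a :* a :* (i :* i) :* (b :* b) := a :* a :* ((b :* i) :* (b :* i))) refl a i b ⟩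
    a * a * ((b * i) * (b * i))              ≈⟨ *-congˡ (trans (*-cong (⁻¹-inverse q) (⁻¹-inverse q)) (*-identityˡ 1#)) ⟩
    a * a * 1#                               ≈⟨ *-identityʳ _ ⟩
    a * a                                    ∎
    where
    open ≈-Reasoning setoid
    a = proj₁ p
    b = proj₁ q
    i = q ⁻¹

  base-inverse : ∀ p q → base p q * base q p ≈ 1#
  base-inverse p q = begin
    base p q * (b * (b * 1#) * (i * (i * 1#)))  ≈⟨ *-congˡ (*-cong (*-congˡ (*-identityʳ b)) (*-congˡ (*-identityʳ i))) ⟩
    base p q * (b * b * (i * i))                ≈⟨ *-assoc _ _ _ ⟨
    base p q * (b * b) * (i * i)                ≈⟨ *-congʳ (base-*-square p q) ⟩
    a * a * (i * i)                             ≈⟨ solve 2 (λ a i → a :* a :* (i :* i) := (a :* i) :* (a :* i)) refl a i ⟩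
    a * i * (a * i)                             ≈⟨ *-cong (⁻¹-inverse p) (⁻¹-inverse p) ⟩
    1# * 1#                                     ≈⟨ *-identityˡ 1# ⟩
    1#                                          ∎
    where
    open ≈-Reasoning setoid
    a = proj₁ p
    b = proj₁ q
    i = p ⁻¹

  -- With Q = p²/q² and first entry X = q^(2n+1) p, the last entry Q^n X is p^(2n+1) q, which is X
  -- with p and q exchanged. This is what `P-reverse` asks for.
  base-power : ∀ p q n → let a = proj₁ p; b = proj₁ q in
    base p q ^ n * (b ^ n * b ^ suc n * a) ≈ a ^ n * a ^ suc n * b
  base-power p q zero    = begin
    1# * (1# * (b * 1#) * a)  ≈⟨ trans (*-identityˡ _) (*-congʳ (trans (*-identityˡ _) (*-identityʳ b))) ⟩
    b * a                     ≈⟨ *-comm b a ⟩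
    a * b                     ≈⟨ *-congʳ (trans (*-identityˡ _) (*-identityʳ a)) ⟨
    1# * (a * 1#) * b         ∎
    where
    open ≈-Reasoning setoid
    a = proj₁ p
    b = proj₁ q
  base-power p q (suc n) = begin
    base p q * base p q ^ n * (b * b ^ n * (b * b ^ suc n) * a)
      ≈⟨ solve 6 (λ e f b g h a → e :* f :* (b :* g :* (b :* h) :* a) := e :* (b :* b) :* (f :* (g :* h :* a)))
           refl (base p q) (base p q ^ n) b (b ^ n) (b ^ suc n) a ⟩
    base p q * (b * b) * (base p q ^ n * (b ^ n * b ^ suc n * a))
      ≈⟨ *-cong (base-*-square p q) (base-power p q n) ⟩
    a * a * (a ^ n * a ^ suc n * b)
      ≈⟨ solve 4 (λ a g h b → a :* a :* (g :* h :* b) := a :* g :* (a :* h) :* b) refl a (a ^ n) (a ^ suc n) b ⟩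
    a * a ^ n * (a * a ^ suc n) * b ∎
    where
    open ≈-Reasoning setoid
    a = proj₁ p
    b = proj₁ q

  const-^ : ∀ a n → const (a ^ n) ≈ˢ const a ^ˢ n
  const-^ a zero    n = refl
  const-^ a (suc m) n = trans (const-* a (a ^ m) n) (*ˢ-congˡ (const a) (const-^ a m) n)

  const-*-𝕩 : ∀ {a b c} → a * b ≈ c → const a *ˢ (const b *ˢ 𝕩) ≈ˢ const c *ˢ 𝕩
  const-*-𝕩 {a} {b} {c} ab≈c = begin
    const a *ˢ (const b *ˢ 𝕩)   ≈⟨ *ˢ-assoc (const a) (const b) 𝕩 ⟨
    const a *ˢ const b *ˢ 𝕩     ≈⟨ *ˢ-congʳ 𝕩 (const-* a b) ⟨
    const (a * b) *ˢ 𝕩          ≈⟨ *ˢ-congʳ 𝕩 (const-cong ab≈c) ⟩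
    const c *ˢ 𝕩                ∎
    where open ≈-Reasoning 𝕊.setoid

  β-suc-suc : ∀ n x p q → let a = proj₁ p; b = proj₁ q in
    β (suc (suc n)) x p q ≈ˢ P (suc (suc n)) (const (b ^ n * b ^ suc n * a) *ˢ x) (const (base p q))
  β-suc-suc n x p q = P-cong (suc (suc n))
    (*ˢ-congʳ x (const-cong (*-congʳ (power-exponent q n)))) (λ _ → refl)

  β-symmetric : ∀ k p q → β k 𝕩 p q ≈ˢ β k 𝕩 q p
  β-symmetric zero          p q n = refl
  β-symmetric (suc zero)    p q n = refl
  β-symmetric (suc (suc n)) p q = begin
    β (suc (suc n)) 𝕩 p q
      ≈⟨ β-suc-suc n 𝕩 p q ⟩
    P (suc (suc n)) (const e *ˢ 𝕩) (const (base p q))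
      ≈⟨ P-reverse n {const e *ˢ 𝕩} {const e′ *ˢ 𝕩} {const (base p q)} {const (base q p)}
           (λ m → trans (sym (const-* (base p q) (base q p) m)) (const-cong (base-inverse p q) m))
           (λ m → trans (sym (const-*-𝕩 (base-power p q n) m)) (*ˢ-congʳ (const e *ˢ 𝕩) (const-^ (base p q) n) m)) ⟩
    P (suc (suc n)) (const e′ *ˢ 𝕩) (const (base q p))
      ≈⟨ β-suc-suc n 𝕩 q p ⟨
    β (suc (suc n)) 𝕩 q p ∎
    where
    open ≈-Reasoning 𝕊.setoid
    e = proj₁ q ^ n * proj₁ q ^ suc n * proj₁ p
    e′ = proj₁ p ^ n * proj₁ p ^ suc n * proj₁ q

  R-symmetric : ∀ h p q → R h 𝕩 p q ≈ˢ R h 𝕩 q p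
  R-symmetric h p q = begin
    R h 𝕩 p q                                                     ≈⟨ R-pred≈∏ (suc h) 𝕩 p q ⟩
    ∏ (b p q) (suc h) *ˢ ∏ (b p q) (suc h) *ˢ b p q (suc h)       ≈⟨ *ˢ-cong (*ˢ-cong ∏≈ ∏≈) (β-symmetric (suc h) p q) ⟩
    ∏ (b q p) (suc h) *ˢ ∏ (b q p) (suc h) *ˢ b q p (suc h)       ≈⟨ R-pred≈∏ (suc h) 𝕩 q p ⟨
    R h 𝕩 q p                                                     ∎
    where
    open ≈-Reasoning 𝕊.setoid
    b : Nonzero → Nonzero → ℕ → Series
    b p q k = β k 𝕩 p q
    ∏≈ : ∏ (b p q) (suc h) ≈ˢ ∏ (b q p) (suc h)
    ∏≈ = ∏-cong {b p q} {b q p} (suc h) (λ k → β-symmetric k p q)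

  R-head : ∀ h p q → R h 𝕩 p q 0 ≈ 1#
  R-head h p q = trans
    (*ˢ-head (productˢ {suc h} F) (evalP (suc h) e 𝕩 p q))
    (trans (*-cong (productˢ-head (suc h) F λ i → ^ˢ-head (β (toℕ i) 𝕩 p q) 2 (evalP-head (toℕ i) (ℤ.+ (2 ℕ.* toℕ i) ℤ.- ℤ.+ 3))) (evalP-head (suc h) e))
      (*-identityˡ 1#))
    where
    e = ℤ.+ (2 ℕ.* h) ℤ.- ℤ.+ 1
    F : Fin (suc h) → Series
    F i = β (toℕ i) 𝕩 p q ^ˢ 2
    evalP-head : ∀ k e → evalP k e 𝕩 p q 0 ≈ 1#
    evalP-head k e = P-head k (const (q ^ℤ e * proj₁ p) *ˢ 𝕩) (const (base p q))
      (trans (*ˢ-head (const (q ^ℤ e * proj₁ p)) 𝕩) (zeroʳ _))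

-- The generating function of paths of fixed height.

module GeneratingFunction {c ℓ₁ ℓ₂} (K : HeytingField c ℓ₁ ℓ₂) (p′ q′ : DyckSeries.Nonzero K) where

  open HeytingField K using (heytingCommutativeRing)
  open DyckSeries K
  open SeriesProperties K
  open WaterCapacity
  open CommutativeRing (HeytingCommutativeRing.commutativeRing heytingCommutativeRing) hiding (rawRing)
  open SemiringExp semiring using (^-congʳ; ^-homo-*)
  open SemiringSum semiring using (sum-cong-≋; ∑-distrib-+)
  open PolynomialProperties (HeytingCommutativeRing.commutativeRing heytingCommutativeRing)
    using (sum-vanishing)
  open Solver commutativeSemiring using (solve; _:=_; _:*_)
  open FiniteProducts seriesRing
  open Factors K

  private module 𝕊 = CommutativeRing seriesRing

  p q : Carrier
  p = proj₁ p′
  q = proj₁ q′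

  open PathSums K p q

  b b⁺ : ℕ → Series
  b  k = β k 𝕩 p′ q′
  b⁺ k = β k (const (p ^ 2) *ˢ 𝕩) p′ q′

  edge : ℕ → ℕ → Carrier
  edge μ y = stepWeight μ y * stepWeight μ (suc y)

  ascent-descent : ∀ μ y → ascent μ y *ˢ descent μ (suc y) ≈ˢ const (edge μ y) *ˢ 𝕩
  ascent-descent μ y = begin
    const a *ˢ 𝕩 *ˢ const a′      ≈⟨ *ˢ-assoc (const a) 𝕩 (const a′) ⟩
    const a *ˢ (𝕩 *ˢ const a′)    ≈⟨ *ˢ-congˡ (const a) (*ˢ-comm 𝕩 (const a′)) ⟩
    const a *ˢ (const a′ *ˢ 𝕩)    ≈⟨ const-*-𝕩 refl ⟩
    const (a * a′) *ˢ 𝕩           ∎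
    where
    open ≈-Reasoning 𝕊.setoid
    a = stepWeight μ y
    a′ = stepWeight μ (suc y)

  edge-ratio : ∀ μ y → suc y ℕ.< μ → base p′ q′ * edge μ (suc y) ≈ edge μ y
  edge-ratio μ y y<μ = begin
    e * (stepWeight μ (suc y) * (p ^ (μ ∸ suc (suc y)) * (q * (q * q ^ y))))
      ≈⟨ solve 5 (λ e w x q z → e :* (w :* (x :* (q :* (q :* z)))) := e :* (q :* q) :* x :* z :* w) refl e (stepWeight μ (suc y)) _ q (q ^ y) ⟩
    e * (q * q) * p ^ (μ ∸ suc (suc y)) * q ^ y * stepWeight μ (suc y)
      ≈⟨ *-congʳ (*-congʳ (*-congʳ (base-*-square p′ q′))) ⟩
    p * p * p ^ (μ ∸ suc (suc y)) * q ^ y * stepWeight μ (suc y)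
      ≈⟨ *-congʳ (*-congʳ (trans (*-assoc p p _) (^-congʳ p (≡.sym (drop-two μ y y<μ))))) ⟩
    p ^ (μ ∸ y) * q ^ y * stepWeight μ (suc y) ∎
    where
    open ≈-Reasoning setoid
    e = base p′ q′
    drop-two : ∀ μ y → suc y ℕ.< μ → μ ∸ y ≡ suc (suc (μ ∸ suc (suc y)))
    drop-two (suc (suc μ)) zero    _         = ≡.refl
    drop-two (suc μ)       (suc y) (s≤s y<μ) = drop-two μ y y<μ

  top-edge : ∀ m → edge (suc m) m ≈ q ^ m * q ^ suc m * p
  top-edge m = begin
    p ^ (suc m ∸ m) * q ^ m * (p ^ (m ∸ m) * q ^ suc m)
      ≡⟨ ≡.cong₂ (λ i j → p ^ i * q ^ m * (p ^ j * q ^ suc m)) (ℕₚ.m+n∸n≡m 1 m) (ℕₚ.n∸n≡0 m) ⟩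
    p * 1# * q ^ m * (1# * q ^ suc m)
      ≈⟨ *-cong (*-congʳ (*-identityʳ p)) (*-identityˡ _) ⟩
    p * q ^ m * q ^ suc m
      ≈⟨ solve 3 (λ p x y → p :* x :* y := x :* y :* p) refl p (q ^ m) (q ^ suc m) ⟩
    q ^ m * q ^ suc m * p ∎
    where open ≈-Reasoning setoid

  -- Weights depend on `M` and `k` only through `M ⊓ k`, so one computation covers left, top and
  -- right gaps.
  minors : ∀ M k μ → M ⊓ k ≡ μ →
    (Level.minor M k μ ≈ˢ b⁺ μ) × (Level.minor M k (suc μ) ≈ˢ b (suc μ))
  minors M k μ ≡.refl = trans-at μ (proj₁ P-minors) lower , 𝕊.trans {Level.minor M k (suc μ)} (proj₂ P-minors) (upper μ)
    where
    open ≈-Reasoning 𝕊.setoid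
    Q = const (base p′ q′)
    top : ℕ → Series
    top μ = ascent μ (pred μ) *ˢ descent μ μ
    P-minors : (Level.minor M k μ ≈ˢ P μ (Q *ˢ top μ) Q) × (Level.minor M k (suc μ) ≈ˢ P (suc μ) (top μ) Q)
    P-minors = Level.minor≈P M k Q μ λ y y<μ → begin
      ascent μ y *ˢ descent μ (suc y)                        ≈⟨ ascent-descent μ y ⟩
      const (edge μ y) *ˢ 𝕩                                  ≈⟨ const-*-𝕩 (edge-ratio μ y y<μ) ⟨
      Q *ˢ (const (edge μ (suc y)) *ˢ 𝕩)                     ≈⟨ *ˢ-congˡ Q (ascent-descent μ (suc y)) ⟨
      Q *ˢ (ascent μ (suc y) *ˢ descent μ (suc (suc y)))     ∎
    trans-at : ∀ μ {f} → f ≈ˢ P μ (Q *ˢ top μ) Q → P μ (Q *ˢ top μ) Q ≈ˢ b⁺ μ → f ≈ˢ b⁺ μ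
    trans-at μ f≈ eq n = trans (f≈ n) (eq n)
    top≈ : ∀ m → top (suc m) ≈ˢ const (q ^ m * q ^ suc m * p) *ˢ 𝕩
    top≈ m = 𝕊.trans {top (suc m)} (ascent-descent (suc m) m) (*ˢ-congʳ 𝕩 (const-cong (top-edge m)))
    upper : ∀ μ → P (suc μ) (top μ) Q ≈ˢ b (suc μ)
    upper zero    n = refl
    upper (suc m) = begin
      P (suc (suc m)) (top (suc m)) Q                         ≈⟨ P-cong (suc (suc m)) {X = top (suc m)} {Q = Q} (top≈ m) (λ _ → refl) ⟩
      P (suc (suc m)) (const (q ^ m * q ^ suc m * p) *ˢ 𝕩) Q  ≈⟨ β-suc-suc m 𝕩 p′ q′ ⟨
      b (suc (suc m))                                         ∎
    -- The origin of the argument p²x: the second highest pair weighs p²/q² times q^(2m+3) p x,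
    -- which is q^(2m+1) p times p²x.
    shifted-edge : ∀ m → base p′ q′ * (q ^ suc m * q ^ suc (suc m) * p) ≈ q ^ m * q ^ suc m * p * p ^ 2
    shifted-edge m = trans
      (solve 5 (λ e q x y p → e :* (q :* x :* (q :* y) :* p) := x :* y :* p :* (e :* (q :* q))) refl (base p′ q′) q (q ^ m) (q ^ suc m) p)
      (*-congˡ (trans (base-*-square p′ q′) (*-congˡ (sym (*-identityʳ p)))))
    lower : P μ (Q *ˢ top μ) Q ≈ˢ b⁺ μ
    lower = lower′ μ
      where
      lower′ : ∀ μ → P μ (Q *ˢ top μ) Q ≈ˢ b⁺ μ
      lower′ zero          n = refl
      lower′ (suc zero)    n = refl
      lower′ (suc (suc m)) = begin
        P (suc (suc m)) (Q *ˢ top (suc (suc m))) Q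
          ≈⟨ P-cong (suc (suc m)) {X = Q *ˢ top (suc (suc m))} {Q = Q} X≈ (λ _ → refl) ⟩
        P (suc (suc m)) (const (q ^ m * q ^ suc m * p) *ˢ (const (p ^ 2) *ˢ 𝕩)) Q
          ≈⟨ β-suc-suc m (const (p ^ 2) *ˢ 𝕩) p′ q′ ⟨
        b⁺ (suc (suc m)) ∎
        where
        X≈ : Q *ˢ top (suc (suc m)) ≈ˢ const (q ^ m * q ^ suc m * p) *ˢ (const (p ^ 2) *ˢ 𝕩)
        X≈ = begin
          Q *ˢ top (suc (suc m))                                          ≈⟨ *ˢ-congˡ Q (top≈ (suc m)) ⟩
          Q *ˢ (const (q ^ suc m * q ^ suc (suc m) * p) *ˢ 𝕩)             ≈⟨ const-*-𝕩 (shifted-edge m) ⟩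
          const (q ^ m * q ^ suc m * p * p ^ 2) *ˢ 𝕩                      ≈⟨ const-*-𝕩 refl ⟨
          const (q ^ m * q ^ suc m * p) *ˢ (const (p ^ 2) *ˢ 𝕩)           ∎

  stepWeight-top : ∀ {μ} y → μ ≡ y → stepWeight μ y ≈ q ^ y
  stepWeight-top y ≡.refl = trans (*-congʳ (^-congʳ p (ℕₚ.n∸n≡0 y))) (*-identityˡ _)

  w : ℕ → Series
  w k = const (q ^ k)

  left-factor : ∀ h M → M ℕ.< h →
    pathSeries M h M *ˢ b (suc M) ≈ˢ b⁺ M *ˢ (w M *ˢ 𝕩) *ˢ pathSeries (suc M) h (suc M)
  left-factor h M M<h = begin
    pathSeries M h M *ˢ b (suc M)
      ≈⟨ *ˢ-congˡ (pathSeries M h M) (proj₂ (minors M h M M⊓h≡M)) ⟨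
    pathSeries M h M *ˢ Level.minor M h (suc M)
      ≈⟨ left-gap M h M<h ⟩
    Level.minor M h M *ˢ (ascent (M ⊓ h) M *ˢ X)
      ≈⟨ *ˢ-cong (proj₁ (minors M h M M⊓h≡M)) (*ˢ-congʳ X (*ˢ-congʳ 𝕩 (const-cong (stepWeight-top M M⊓h≡M)))) ⟩
    b⁺ M *ˢ (w M *ˢ 𝕩 *ˢ X)
      ≈⟨ *ˢ-assoc (b⁺ M) (w M *ˢ 𝕩) X ⟨
    b⁺ M *ˢ (w M *ˢ 𝕩) *ˢ X ∎
    where
    open ≈-Reasoning 𝕊.setoid
    X = pathSeries (suc M) h (suc M)
    M⊓h≡M : M ⊓ h ≡ M
    M⊓h≡M = ℕₚ.m≤n⇒m⊓n≡m (ℕₚ.<⇒≤ M<h)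

  right-factor : ∀ h k → k ℕ.< h →
    pathSeries h (suc k) (suc k) *ˢ b (suc (suc k)) ≈ˢ b⁺ (suc k) *ˢ w (suc k) *ˢ pathSeries h k k
  right-factor h k k<h = begin
    pathSeries h (suc k) (suc k) *ˢ b (suc (suc k))
      ≈⟨ *ˢ-congˡ (pathSeries h (suc k) (suc k)) (proj₂ (minors h (suc k) (suc k) h⊓k≡k)) ⟨
    pathSeries h (suc k) (suc k) *ˢ Level.minor h (suc k) (suc (suc k))
      ≈⟨ right-gap h k k<h ⟩
    Level.minor h (suc k) (suc k) *ˢ (descent (h ⊓ suc k) (suc k) *ˢ X)
      ≈⟨ *ˢ-cong (proj₁ (minors h (suc k) (suc k) h⊓k≡k)) (*ˢ-congʳ X (const-cong (stepWeight-top (suc k) h⊓k≡k))) ⟩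
    b⁺ (suc k) *ˢ (w (suc k) *ˢ X)
      ≈⟨ *ˢ-assoc (b⁺ (suc k)) (w (suc k)) X ⟨
    b⁺ (suc k) *ˢ w (suc k) *ˢ X ∎
    where
    open ≈-Reasoning 𝕊.setoid
    X = pathSeries h k k
    h⊓k≡k : h ⊓ suc k ≡ suc k
    h⊓k≡k = ℕₚ.m≥n⇒m⊓n≡n k<h

  square-suc : ∀ h → const (q ^ (suc h ℕ.* suc h)) ≈ˢ const (q ^ (h ℕ.* h)) *ˢ (w h *ˢ w (suc h))
  square-suc h = begin
    const (q ^ (suc h ℕ.* suc h))
      ≈⟨ const-cong (trans (^-congʳ q (square h)) (trans (^-homo-* q (h ℕ.* h) _) (*-congˡ (^-homo-* q h (suc h))))) ⟩
    const (q ^ (h ℕ.* h) * (q ^ h * q ^ suc h))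
      ≈⟨ const-* (q ^ (h ℕ.* h)) (q ^ h * q ^ suc h) ⟩
    const (q ^ (h ℕ.* h)) *ˢ const (q ^ h * q ^ suc h)
      ≈⟨ *ˢ-congˡ (const (q ^ (h ℕ.* h))) (const-* (q ^ h) (q ^ suc h)) ⟩
    const (q ^ (h ℕ.* h)) *ˢ (w h *ˢ w (suc h)) ∎
    where
    open ≈-Reasoning 𝕊.setoid
    square : ∀ h → suc h ℕ.* suc h ≡ h ℕ.* h ℕ.+ (h ℕ.+ suc h)
    square = solve-∀

  -- The left gaps supply the denominators b_1, ..., b_h and the numerators b⁺_0, ..., b⁺_(h-1), the
  -- top and right gaps b_2, ..., b_(h+1) and b⁺_1, ..., b⁺_h. Since b_0 = b_1 = b⁺_0 = 1, these are
  -- the factors of R_h at x and of R_(h-1) at p²x.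
  pathSeries-product : ∀ h →
    pathSeries 0 h 0 *ˢ R h 𝕩 p′ q′ ≈ˢ
      𝕩 ^ˢ h *ˢ const (q ^ (h ℕ.* h)) *ˢ R-pred h (const (p ^ 2) *ˢ 𝕩) p′ q′
  pathSeries-product h = begin
    S₀ *ˢ R h 𝕩 p′ q′
      ≈⟨ *ˢ-congˡ S₀ (R-pred≈∏ (suc h) 𝕩 p′ q′) ⟩
    S₀ *ˢ (∏ b (suc h) *ˢ ∏ b (suc h) *ˢ b (suc h))
      ≈⟨ *ˢ-congˡ S₀ (*ˢ-assoc (∏ b (suc h)) (∏ b (suc h)) (b (suc h))) ⟩
    S₀ *ˢ (∏ b (suc h) *ˢ (∏ b (suc h) *ˢ b (suc h)))
      ≈⟨ *ˢ-congˡ S₀ (*ˢ-cong (∏-tail b h b₀≈1) (∏-tail b (suc h) b₀≈1)) ⟨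
    S₀ *ˢ (∏ (b ∘ suc) h *ˢ ∏ (b ∘ suc) (suc h))
      ≈⟨ *ˢ-congˡ S₀ (*ˢ-congˡ (∏ (b ∘ suc) h) (∏-tail (b ∘ suc) h b₁≈1)) ⟨
    S₀ *ˢ (∏ (b ∘ suc) h *ˢ ∏ (b ∘ suc ∘ suc) h)
      ≈⟨ *ˢ-assoc S₀ (∏ (b ∘ suc) h) (∏ (b ∘ suc ∘ suc) h) ⟨
    S₀ *ˢ ∏ (b ∘ suc) h *ˢ ∏ (b ∘ suc ∘ suc) h
      ≈⟨ *ˢ-congʳ (∏ (b ∘ suc ∘ suc) h)
           (telescope-up (λ M → pathSeries M h M) (b ∘ suc) F h (left-factor h) h ℕₚ.≤-refl) ⟩
    ∏ F h *ˢ pathSeries h h h *ˢ ∏ (b ∘ suc ∘ suc) h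
      ≈⟨ *ˢ-assoc (∏ F h) (pathSeries h h h) (∏ (b ∘ suc ∘ suc) h) ⟩
    ∏ F h *ˢ (pathSeries h h h *ˢ ∏ (b ∘ suc ∘ suc) h)
      ≈⟨ *ˢ-congˡ (∏ F h)
           (telescope-down (λ k → pathSeries h k k) (b ∘ suc ∘ suc) F′ h (pathSeries-0 h) (right-factor h) h ℕₚ.≤-refl) ⟩
    ∏ F h *ˢ ∏ F′ h
      ≈⟨ ∏-numerators {𝕩} {λ h → const (q ^ (h ℕ.* h))} b⁺ w (λ _ → refl) square-suc h ⟩
    xq *ˢ (∏ b⁺ h *ˢ ∏ (b⁺ ∘ suc) h)
      ≈⟨ *ˢ-congˡ xq (*ˢ-congˡ (∏ b⁺ h) (∏-tail b⁺ h b⁺₀≈1)) ⟩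
    xq *ˢ (∏ b⁺ h *ˢ (∏ b⁺ h *ˢ b⁺ h))
      ≈⟨ *ˢ-congˡ xq (*ˢ-assoc (∏ b⁺ h) (∏ b⁺ h) (b⁺ h)) ⟨
    xq *ˢ (∏ b⁺ h *ˢ ∏ b⁺ h *ˢ b⁺ h)
      ≈⟨ *ˢ-congˡ xq (R-pred≈∏ h (const (p ^ 2) *ˢ 𝕩) p′ q′) ⟨
    xq *ˢ R-pred h (const (p ^ 2) *ˢ 𝕩) p′ q′ ∎
    where
    open ≈-Reasoning 𝕊.setoid
    S₀ = pathSeries 0 h 0
    xq = 𝕩 ^ˢ h *ˢ const (q ^ (h ℕ.* h))
    F F′ : ℕ → Series
    F k = b⁺ k *ˢ (w k *ˢ 𝕩)
    F′ k = b⁺ (suc k) *ˢ w (suc k)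
    b₀≈1 : b 0 ≈ˢ 1ˢ
    b₀≈1 = β-0 𝕩 p′ q′
    b₁≈1 : b 1 ≈ˢ 1ˢ
    b₁≈1 = P-1 1ˢ 1ˢ
    b⁺₀≈1 : b⁺ 0 ≈ˢ 1ˢ
    b⁺₀≈1 = β-0 (const (p ^ 2) *ˢ 𝕩) p′ q′

  -- Sorting Dyck paths by height.

  ∑-filter : ∀ {A : Set} {P : A → Set} (P? : ∀ x → Dec (P x)) (f : A → Carrier) xs →
    ∑ f (filter P? xs) ≈ ∑ (λ x → indicator (P? x) (f x)) xs
  ∑-filter P? f []       = refl
  ∑-filter P? f (x ∷ xs) with P? x
  ... | yes _ = +-congˡ (∑-filter P? f xs)
  ... | no  _ = trans (∑-filter P? f xs) (sym (+-identityˡ _))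

  ∑-sum : ∀ {A : Set} n (F : ℕ → A → Carrier) xs →
    ∑ (λ x → sumᴷ {n} (λ i → F (toℕ i) x)) xs ≈ sumᴷ {n} (λ i → ∑ (F (toℕ i)) xs)
  ∑-sum n F []       = sym (sum-vanishing n (λ _ → 0#) λ _ → refl)
  ∑-sum n F (x ∷ xs) = trans (+-congˡ (∑-sum n F xs))
    (sym (∑-distrib-+ {n} (λ i → F (toℕ i) x) (λ i → ∑ (F (toℕ i)) xs)))

  indicator-cong : ∀ {a b} {A : Set a} {B : Set b} (A? : Dec A) (B? : Dec B) {x y} → (A → B) → (B → A) →
    (A → x ≈ y) → indicator A? x ≈ indicator B? y
  indicator-cong A? B? f g eq =
    trans (indicator-scale A? B? {y = 1#} f g (λ a → trans (eq a) (sym (*-identityˡ _)))) (*-identityˡ _)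

  sum-delta : ∀ (f : ℕ → Carrier) m n →
    sumᴷ {n} (λ i → indicator (m ℕₚ.≟ toℕ i) (f (toℕ i))) ≈ indicator (m ℕₚ.<? n) (f m)
  sum-delta f m       zero    = sym (indicator-no (m ℕₚ.<? 0) {f m} λ ())
  sum-delta f zero    (suc n) = trans (+-congˡ (sum-vanishing n (λ i → indicator (0 ℕₚ.≟ suc i) (f (suc i)))
      λ i → indicator-no (0 ℕₚ.≟ suc i) {f (suc i)} λ ()))
    (trans (+-identityʳ _) (trans (indicator-yes (0 ℕₚ.≟ 0) ≡.refl) (sym (indicator-yes (0 ℕₚ.<? suc n) (s≤s z≤n)))))
  sum-delta f (suc m) (suc n) = begin
    indicator (suc m ℕₚ.≟ 0) (f 0) + sumᴷ {n} (λ i → indicator (suc m ℕₚ.≟ suc (toℕ i)) (f (suc (toℕ i))))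
      ≈⟨ +-cong (indicator-no (suc m ℕₚ.≟ 0) {f 0} λ ()) (sum-cong-≋ {n} λ i →
           indicator-cong (suc m ℕₚ.≟ suc (toℕ i)) (m ℕₚ.≟ toℕ i) ℕₚ.suc-injective (≡.cong suc) (λ _ → refl)) ⟩
    0# + sumᴷ {n} (λ i → indicator (m ℕₚ.≟ toℕ i) (f (suc (toℕ i))))
      ≈⟨ trans (+-identityˡ _) (sum-delta (f ∘ suc) m n) ⟩
    indicator (m ℕₚ.<? n) (f (suc m))
      ≈⟨ indicator-cong (m ℕₚ.<? n) (suc m ℕₚ.<? suc n) s≤s ℕₚ.≤-pred (λ _ → refl) ⟩
    indicator (suc m ℕₚ.<? suc n) (f (suc m)) ∎
    where open ≈-Reasoning setoid

  insert-factor : ∀ f g h k {S} → S ≈ˢ g *ˢ h *ˢ k → f *ˢ S ≈ˢ g *ˢ f *ˢ h *ˢ k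
  insert-factor f g h k {S} S≈ = begin
    f *ˢ S                ≈⟨ *ˢ-congˡ f S≈ ⟩
    f *ˢ (g *ˢ h *ˢ k)    ≈⟨ *ˢ-assoc f (g *ˢ h) k ⟨
    f *ˢ (g *ˢ h) *ˢ k    ≈⟨ *ˢ-congʳ k (*ˢ-assoc f g h) ⟨
    f *ˢ g *ˢ h *ˢ k      ≈⟨ *ˢ-congʳ k (*ˢ-congʳ h (*ˢ-comm f g)) ⟩
    g *ˢ f *ˢ h *ˢ k      ∎
    where open ≈-Reasoning 𝕊.setoid

  module _ (N : ℕ) (y : Carrier) where

    pathWeight : Path → Carrier
    pathWeight π = y ^ height π * p ^ waterCapacity π * q ^ properArea π

    -- Exactly one summand survives, the one at the height of the path. The truncation by `N` thus
    -- becomes the range of a sum, which can be exchanged with the sum over paths.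
    weight-by-height : ∀ π →
      indicator (dyckFrom? 0 π) (indicator (height π ℕₚ.≤? N) (pathWeight π))
        ≈ sumᴷ {suc N} (λ i → y ^ toℕ i * term 0 (toℕ i) 0 π)
    weight-by-height π = by-cases (dyckFrom? 0 π)
      where
      open ≈-Reasoning setoid
      by-cases : Dec (DyckFrom 0 π) →
        indicator (dyckFrom? 0 π) (indicator (height π ℕₚ.≤? N) (pathWeight π))
          ≈ sumᴷ {suc N} (λ i → y ^ toℕ i * term 0 (toℕ i) 0 π)
      by-cases (no ¬d) = trans (indicator-no (dyckFrom? 0 π) ¬d)
        (sym (sum-vanishing (suc N) (λ i → y ^ i * term 0 i 0 π)
          λ i → trans (*-congˡ (term-zero 0 i 0 π (¬d ∘ proj₁))) (zeroʳ _)))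
      by-cases (yes d) = begin
        indicator (dyckFrom? 0 π) (indicator (height π ℕₚ.≤? N) (pathWeight π))
          ≈⟨ indicator-yes (dyckFrom? 0 π) d ⟩
        indicator (height π ℕₚ.≤? N) (pathWeight π)
          ≈⟨ indicator-cong (height π ℕₚ.≤? N) (peak 0 π ℕₚ.<? suc N)
               (λ h≤N → s≤s (≡.subst (ℕ._≤ N) (height≡peak d) h≤N))
               (λ { (s≤s h≤N) → ≡.subst (ℕ._≤ N) (≡.sym (height≡peak d)) h≤N })
               (λ _ → trans (*-congʳ (*-cong (^-congʳ y (height≡peak d)) (^-congʳ p (waterCapacity≡water π d)))) (*-assoc _ _ _)) ⟩
        indicator (peak 0 π ℕₚ.<? suc N) (y ^ peak 0 π * weight 0 0 π)
          ≈⟨ sum-delta (λ i → y ^ i * weight 0 0 π) (peak 0 π) (suc N) ⟨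
        sumᴷ {suc N} (λ i → indicator (peak 0 π ℕₚ.≟ toℕ i) (y ^ toℕ i * weight 0 0 π))
          ≈⟨ sum-cong-≋ {suc N} (λ i → indicator-scale (peak 0 π ℕₚ.≟ toℕ i) (dyckPeak? (toℕ i) 0 π) {y = y ^ toℕ i} {z = weight 0 0 π}
               (d ,_) proj₂ (λ _ → refl)) ⟩
        sumᴷ {suc N} (λ i → y ^ toℕ i * term 0 (toℕ i) 0 π) ∎

    G-by-height : ∀ n → G N y p q n ≈ sumᴷ {suc N} (λ i → y ^ toℕ i * pathSeries 0 (toℕ i) 0 n)
    G-by-height n = begin
      ∑ pathWeight (filter (λ π → height π ℕₚ.≤? N) (dyckPaths n))
        ≈⟨ ∑-filter (λ π → height π ℕₚ.≤? N) pathWeight (dyckPaths n) ⟩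
      ∑ (λ π → indicator (height π ℕₚ.≤? N) (pathWeight π)) (dyckPaths n)
        ≈⟨ ∑-filter (dyckFrom? 0) (λ π → indicator (height π ℕₚ.≤? N) (pathWeight π)) (words (2 ℕ.* n)) ⟩
      ∑ (λ π → indicator (dyckFrom? 0 π) (indicator (height π ℕₚ.≤? N) (pathWeight π))) (words (2 ℕ.* n))
        ≈⟨ ∑-cong (words (2 ℕ.* n)) weight-by-height ⟩
      ∑ (λ π → sumᴷ {suc N} (λ i → y ^ toℕ i * term 0 (toℕ i) 0 π)) (words (2 ℕ.* n))
        ≈⟨ ∑-sum (suc N) (λ i π → y ^ i * term 0 i 0 π) (words (2 ℕ.* n)) ⟩
      sumᴷ {suc N} (λ i → ∑ (λ π → y ^ toℕ i * term 0 (toℕ i) 0 π) (words (2 ℕ.* n)))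
        ≈⟨ sum-cong-≋ {suc N} (λ i → trans (∑-* (y ^ toℕ i) (term 0 (toℕ i) 0) (words (2 ℕ.* n)))
             (*-congˡ (reflexive (≡.cong (pathSum 0 (toℕ i) 0) (≡.sym (ℕₚ.+-identityʳ (2 ℕ.* n))))))) ⟩
      sumᴷ {suc N} (λ i → y ^ toℕ i * pathSeries 0 (toℕ i) 0 n) ∎
      where open ≈-Reasoning setoid

    G≈sum : ∀ {r : ℕ → Series} → (∀ h → r h ≈ˢ R h 𝕩 p′ q′) →
      G N y p q ≈ˢ sumˢ {suc N} (λ i → let h = toℕ i in
        𝕩 ^ˢ h *ˢ const (y ^ h) *ˢ const (q ^ (h ℕ.* h))
          *ˢ (R-pred h (const (p ^ 2) *ˢ 𝕩) p′ q′ /ˢ r h))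
    G≈sum {r} r≈ n = trans (G-by-height n) (trans
      (sum-cong-≋ {suc N} λ i → summand≈ (toℕ i) n)
      (sym (sumˢ-coefficient (suc N) (λ i → summand (toℕ i)) n)))
      where
      r⁻ summand : ℕ → Series
      r⁻ h = R-pred h (const (p ^ 2) *ˢ 𝕩) p′ q′
      summand h = 𝕩 ^ˢ h *ˢ const (y ^ h) *ˢ const (q ^ (h ℕ.* h)) *ˢ (r⁻ h /ˢ r h)
      product : ∀ h → pathSeries 0 h 0 *ˢ r h ≈ˢ 𝕩 ^ˢ h *ˢ const (q ^ (h ℕ.* h)) *ˢ r⁻ h
      product h = 𝕊.trans {pathSeries 0 h 0 *ˢ r h} (*ˢ-congˡ (pathSeries 0 h 0) (r≈ h)) (pathSeries-product h)
      summand≈ : ∀ h n → y ^ h * pathSeries 0 h 0 n ≈ summand h n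
      summand≈ h n = trans (sym (const-*ˢ (y ^ h) (pathSeries 0 h 0) n))
        (insert-factor (const (y ^ h)) (𝕩 ^ˢ h) (const (q ^ (h ℕ.* h))) (r⁻ h /ˢ r h)
          (quotient-unique (r h) (trans (r≈ h 0) (R-head h p′ q′))
            (𝕩 ^ˢ h *ˢ const (q ^ (h ℕ.* h))) (r⁻ h) (pathSeries 0 h 0) (product h)) n)

  -- The series r is R h 𝕩 p′ q′; with that in place of r, comparing two copies
  -- of this statement is too slow.
  expansion : ∀ {r : ℕ → Series} → ((h : ℕ) → r h ≈ˢ R h 𝕩 q′ p′) →
    (N : ℕ) (y : Carrier) →
      G N y p q ≈ˢ
      sumˢ {suc N} (λ i → let h = toℕ i in
        𝕩 ^ˢ h *ˢ const (y ^ h) *ˢ const (q ^ (h ℕ.* h))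
          *ˢ (R-pred h (const (p ^ 2) *ˢ 𝕩) p′ q′ /ˢ r h))
  expansion r≈ N y = G≈sum N y λ h n → trans (r≈ h n) (R-symmetric h q′ p′ n)

-- With Σ, unlike with its synonym _×_, Agda unifies the result type with that
-- of the theorem before it looks at the arguments, and so finds the r of
-- expansion without unfolding R.
pair-with : ∀ {a b} {A : Set a} {B : Set b} → (A → B) → A → Σ A (λ _ → B)
pair-with f x = x , f x

mainTheorem3 : ∀ {c ℓ₁ ℓ₂} (K : HeytingField c ℓ₁ ℓ₂) →
    let open HeytingField K
        open DyckSeries K
    in
    (p q : Carrier) (pq≠0 : p * q # 0#) →
    let p′ = p , factorˡ-#0 pq≠0
        q′ = q , factorʳ-#0 pq≠0
    in
    ((h : ℕ) → R h 𝕩 p′ q′ ≈ˢ R h 𝕩 q′ p′)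
    ×
    ((N : ℕ) (y : Carrier) →
      G N y p q ≈ˢ
      sumˢ {suc N} (λ i → let h = toℕ i in
        𝕩 ^ˢ h *ˢ const (y ^ h) *ˢ const (q ^ (h ℕ.* h))
          *ˢ (R-pred h (const (p ^ 2) *ˢ 𝕩) p′ q′ /ˢ R h 𝕩 p′ q′)))
mainTheorem3 K p q pq≠0 = pair-with
  (GeneratingFunction.expansion K (p , _) (q , _))
  (λ h → Factors.R-symmetric K h (p , _) (q , _))
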